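{- Let $n\ge 1$ and let $\delta\colon\{1,\dots,n\}\to\{0,1\}$ be any increment function of size $n$. The alt-Tamari poset $\operatorname{Tam}^\delta_n$ contains: \begin{itemize} \item $\displaystyle \frac{1}{n+1}\binom{2n}{n}$ linear intervals of height $0$, \item $\displaystyle \binom{2n-1}{n-2}$ linear intervals of height $1$, \item $\displaystyle 2\binom{2n-k}{n-k-1}$ linear intervals of height $k$, for $2\le k<n$. \end{itemize} Furthermore, there are no linear intervals of height $k\ge n$.
   Context: Binomial coefficients $\binom{a}{b}$ with $b<0$ or $b>a$ are $0$. Intervals. In a finite poset, for $P\le Q$ the interval $[P,Q]$ is the set of $R$ with $P\le R\le Q$. Its height is the maximal length $k$ of a chain $P=P_0<P_1<\dots<P_k=Q$. It is linear if it is totally ordered. Dyck paths. A Dyck path of size (or length) $n$ is a word with $n$ letters $u$ (up steps) and $n$ letters $d$ (down steps) such that every prefix contains at least as many $u$ as $d$. Its up steps are numbered $u_1,\dots,u_n$ from left to right. A subword is a portion of consecutive letters. A valley is a down step immediately followed by an up step. Alt-Tamari posets. An increment function of size $n$ is a function $\delta\colon\{1,\dots,n\}\to\{0,1\}$. Put $\delta(u_i)=\delta(i)$, $\delta(d)=-1$, and $\delta(A)=\sum_{s\in A}\delta(s)$ for a subword $A$ of a Dyck path $P$ of size $n$. The $\delta$-excursion of $u_i$ in $P$ is the smallest (nonempty) subword $C_i$ of $P$ starting with $u_i$ such that $\delta(C_i)=0$ (it always exists). If $P$ has a valley $du_i$, the $\delta$-rotation of $P$ at $u_i$ is the Dyck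 path $Q$ obtained by exchanging the down step preceding $u_i$ with the $\delta$-excursion $C_i$ of $u_i$: $P=A\,d\,C_i\,B$ and $Q=A\,C_i\,d\,B$. The alt-Tamari poset $\operatorname{Tam}^\delta_n$ is the set of Dyck paths of size $n$ with the order given by the reflexive transitive closure of the relation "$Q$ is a $\delta$-rotation of $P$" (with $P$ below $Q$); this is a partial order. -}

module Defs where

open import Data.Fin.Base using (Fin; toℕ; fromℕ<)
open import Data.Integer.Base as ℤ using (ℤ; +_; -[1+_]; 0ℤ; -1ℤ)
open import Data.List.Base using (List; []; _∷_; _++_; inits; length)
open import Data.List.Membership.Propositional using (_∈_)
open import Data.List.Relation.Unary.All as All using (All)
open import Data.List.Relation.Unary.Unique.Propositional using (Unique)
open import Data.Nat.Base using (ℕ; suc; _+_; _≤_; _<_)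
open import Data.Nat.Combinatorics using () renaming (_C_ to _choose_)
open import Data.Nat.Properties as ℕₚ using (_<?_)
open import Data.Product.Base using (_×_; _,_; ∃-syntax)
open import Data.Sum.Base using (_⊎_)
open import Function.Bundles using (_⇔_)
open import Level using (0ℓ; _⊔_)
open import Relation.Binary.Bundles using (Poset)
open import Relation.Binary.Construct.Closure.ReflexiveTransitive
  using (Star; ε; _◅_)
import Relation.Binary.Construct.Closure.ReflexiveTransitive.Properties as Starₚ
import Relation.Binary.Construct.NonStrictToStrict as Strict
open import Relation.Binary.PropositionalEquality
  using (_≡_; refl; sym; cong; subst₂)
open import Relation.Nullary using (yes; no; contradiction)
open import Relation.Unary using (Pred)

-- Zero for a negative lower index; the library's coefficient already vanishes
-- when the lower index exceeds the upper one.

binomial : ℕ → ℤ → ℕ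
binomial a (+ b)    = a choose b
binomial a -[1+ _ ] = 0

HasCardinality : ∀ {a ℓ} {A : Set a} → Pred A ℓ → ℕ → Set (a ⊔ ℓ)
HasCardinality {A = A} S N =
  ∃[ xs ] Unique xs × (∀ (x : A) → x ∈ xs ⇔ S x) × length xs ≡ N

module Intervals {c ℓ₁ ℓ₂} (𝒫 : Poset c ℓ₁ ℓ₂) where
  open Poset 𝒫 using (Carrier; _≈_) renaming (_≤_ to _⊑_)
  open Strict _≈_ _⊑_ using () renaming (_<_ to _⊏_)

  Between : Carrier → Carrier → Pred Carrier ℓ₂
  Between P Q R = P ⊑ R × R ⊑ Q

  IsLinear : Carrier → Carrier → Set (c ⊔ ℓ₂)
  IsLinear P Q = ∀ R S → Between P Q R → Between P Q S → R ⊑ S ⊎ S ⊑ R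

  data Chain : Carrier → Carrier → ℕ → Set (c ⊔ ℓ₁ ⊔ ℓ₂) where
    stop : ∀ {P Q} → P ≈ Q → Chain P Q 0
    step : ∀ {P R Q k} → P ⊏ R → Chain R Q k → Chain P Q (suc k)

  HasHeight : Carrier → Carrier → ℕ → Set (c ⊔ ℓ₁ ⊔ ℓ₂)
  HasHeight P Q k = Chain P Q k × (∀ j → Chain P Q j → j ≤ k)

  -- A nonempty interval determines its endpoints, so intervals are counted
  -- as pairs.

  LinearIntervalOfHeight : ℕ → Pred (Carrier × Carrier) (c ⊔ ℓ₁ ⊔ ℓ₂)
  LinearIntervalOfHeight k (P , Q) = P ⊑ Q × IsLinear P Q × HasHeight P Q k

open Intervals public using (LinearIntervalOfHeight)

data Step : Set where
  u d : Step

#u : List Step → ℕ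
#u []      = 0
#u (u ∷ w) = suc (#u w)
#u (d ∷ w) = #u w

#d : List Step → ℕ
#d []      = 0
#d (u ∷ w) = #d w
#d (d ∷ w) = suc (#d w)

record DyckPath (n : ℕ) : Set where
  field
    word   : List Step
    ups    : #u word ≡ n
    downs  : #d word ≡ n
    ballot : All (λ w → #d w ≤ #u w) (inits word)

open DyckPath public

-- The remaining fields are propositions, so equality of Dyck paths is equality
-- of words.

word-injective : ∀ {n} {P Q : DyckPath n} → word P ≡ word Q → P ≡ Q
word-injective {P = record { ups = a ; downs = b ; ballot = c }}
               {Q = record { ups = a′ ; downs = b′ ; ballot = c′ }} refl
  with refl ← ℕₚ.≡-irrelevant a a′
     | refl ← ℕₚ.≡-irrelevant b b′
     | refl ← All.irrelevant ℕₚ.≤-irrelevant c c′ = refl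

Increment : ℕ → Set
Increment n = Fin n → Fin 2

-- The value of δ on the up step preceded by i other up steps, i.e. up steps
-- are numbered from 0.  The value 0 for i ≥ n is never used in a Dyck path of
-- size n.

δ-up : ∀ {n} → Increment n → ℕ → ℤ
δ-up {n} δ i with i <? n
... | yes i<n = + toℕ (δ (fromℕ< i<n))
... | no  _   = 0ℤ

-- δ-sum δ i A is δ(A) for a subword A preceded by exactly i up steps in the
-- whole path.

δ-sum : ∀ {n} → Increment n → ℕ → List Step → ℤ
δ-sum δ i []      = 0ℤ
δ-sum δ i (u ∷ w) = δ-up δ i ℤ.+ δ-sum δ (suc i) w
δ-sum δ i (d ∷ w) = -1ℤ ℤ.+ δ-sum δ i w

-- Here R is the part of a path that follows its first i up steps and begins
-- with the next up step, and C ranges over the subwords starting with that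
-- up step.

record IsBalanced {n} (δ : Increment n) (i : ℕ) (R C : List Step) : Set where
  field
    starts-with-u : ∃[ X ] C ≡ u ∷ X
    is-prefix     : ∃[ B ] C ++ B ≡ R
    sum-zero      : δ-sum δ i C ≡ 0ℤ

IsExcursion : ∀ {n} → Increment n → ℕ → List Step → List Step → Set
IsExcursion δ i R C =
  IsBalanced δ i R C × (∀ X → IsBalanced δ i R X → length C ≤ length X)

record Rotation {n} (δ : Increment n) (P Q : DyckPath n) : Set where
  field
    A C B     : List Step
    source    : word P ≡ A ++ d ∷ C ++ B
    target    : word Q ≡ A ++ C ++ d ∷ B
    excursion : IsExcursion δ (#u A) (C ++ B) C

-- Antisymmetry: a rotation strictly decreases the number of pairs formed by a
-- down step and a later up step.  In inv j w, the word w is preceded by j down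
-- steps.

inv : ℕ → List Step → ℕ
inv j []      = 0
inv j (u ∷ w) = j + inv j w
inv j (d ∷ w) = inv (suc j) w

inv-shift : ∀ j C B → inv j (C ++ d ∷ B) ≤ inv (suc j) (C ++ B)
inv-shift j []      B = ℕₚ.≤-refl
inv-shift j (u ∷ C) B = ℕₚ.+-mono-≤ (ℕₚ.n≤1+n j) (inv-shift j C B)
inv-shift j (d ∷ C) B = inv-shift (suc j) C B

inv-rotate : ∀ j A X B →
  inv j (A ++ (u ∷ X) ++ d ∷ B) < inv j (A ++ d ∷ (u ∷ X) ++ B)
inv-rotate j []      X B = ℕₚ.+-mono-<-≤ (ℕₚ.n<1+n j) (inv-shift j X B)
inv-rotate j (u ∷ A) X B = ℕₚ.+-monoʳ-< j (inv-rotate j A X B)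
inv-rotate j (d ∷ A) X B = inv-rotate (suc j) A X B

module _ {n} (δ : Increment n) where

  Rotation⇒< : ∀ {P Q} → Rotation δ P Q → inv 0 (word Q) < inv 0 (word P)
  Rotation⇒< record { A = A ; B = B ; source = s ; target = t
                    ; excursion = record { starts-with-u = X , refl } , _ } =
    subst₂ _<_ (cong (inv 0) (sym t)) (cong (inv 0) (sym s))
      (inv-rotate 0 A X B)

  Star⇒≤ : ∀ {P Q} → Star (Rotation δ) P Q → inv 0 (word Q) ≤ inv 0 (word P)
  Star⇒≤ ε        = ℕₚ.≤-refl
  Star⇒≤ (r ◅ rs) = ℕₚ.≤-trans (Star⇒≤ rs) (ℕₚ.<⇒≤ (Rotation⇒< r))

  Star-antisym : ∀ {P Q} →
    Star (Rotation δ) P Q → Star (Rotation δ) Q P → P ≡ Q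
  Star-antisym ε        _  = refl
  Star-antisym (r ◅ rs) ss =
    contradiction
      (ℕₚ.≤-<-trans (ℕₚ.≤-trans (Star⇒≤ ss) (Star⇒≤ rs)) (Rotation⇒< r))
      (ℕₚ.<-irrefl refl)

Tam : ∀ {n} → Increment n → Poset 0ℓ 0ℓ 0ℓ
Tam {n} δ = record
  { Carrier        = DyckPath n
  ; _≈_            = _≡_
  ; _≤_            = Star (Rotation δ)
  ; isPartialOrder = record
    { isPreorder = Starₚ.isPreorder (Rotation δ)
    ; antisym    = Star-antisym δ
    }
  }

{-# OPTIONS --safe #-}
module Submission where

-- Linear intervals are classified and then counted.
--
-- Classification.  An interval [P , Q] with P ≠ Q is linear exactly when it
-- has one of two forms:
--   left   P = A d C₁ ... C_k B  and  Q = A C₁ ... C_k d B, where C₁, ..., C_k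
--          are consecutive excursions, jumped over one after the other by a
--          single down step;
--   right  P = A d^k C B  and  Q = A C d^k B, where C is an excursion, which
--          passes k down steps one after the other.
-- Such an interval is a chain of k + 1 elements, so its height is k.  The two
-- forms coincide for k = 1 and exclude each other for k ≥ 2.
--
-- The order is studied on words, and everything rests on one monotonicity
-- (follow).  Let C be an excursion.  A rotation of C X takes place in C or in
-- X, or it moves the last letter of C, a down step, over an excursion at the
-- start of X; the third kind gives the initial excursion more up steps, and
-- these are never lost again.  So above C X either both parts have evolved
-- independently or the initial excursion has strictly more up steps.  Two
-- consequences are used throughout.  If C B ≤ v and d^k v ≤ C B′, then v is C
-- followed by a word above B (pinch).  If d C B ≤ w and w starts with an up
-- step, then C d B ≤ w (jump).  They show that, within an interval of either
-- form, everything above its bottom P except P itself lies above one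
-- particular rotation of P; this makes the interval a chain (Lin).
--
-- For the converse (shape), a common prefix is removed, so that P = d p and Q
-- starts with an up step.  If p = C B, then linearity forces v = C B whenever
-- C B ≤ v and d v ≤ Q (clash), because d v and C d B must be comparable.  This
-- rigidity excludes everything except a left interval, found by recursion on
-- the part after C.  If p starts with a down step, then P ≤ d C B and
-- C d B ≤ Q for some C and B.  By recursion [p , C B] has one of the two forms;
-- a left interval of height at least 2 would give incomparable elements, so it
-- is a right interval.  Then [P , C d B] is one too, and right-maximal shows
-- that Q = C d B.
--
-- Counting.  By Pascal's rule, binomial (a + b) (b - l) words with a up steps
-- and b down steps reach level -l, provided b ≤ a + l (card-hits; the usual
-- proof is reflection).  Cut at the first visit of its minimum, such a word is
-- R d A with R descending to its minimum, at its end, and A never going below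
-- its start (card-halves).  A right interval amounts to such a pair, because
-- P = A d^k u R, where u R = C B: the word R d A has n - 1 up steps and
-- n + 1 - k down steps and reaches level -2.  In a left interval, delete from
-- C₁ ... C_k B the up steps that open C₁, ..., C_k; they can be put back in a
-- unique way (excs-exist, excs-uniqueᵀ), and with R the remaining word, R d A
-- has n - k up steps and n down steps and reaches level -(k + 1).  Both counts
-- are binomial (2n - k) (n - k - 1).  The intervals of height 0 are the Dyck
-- paths, counted by ballot numbers (card-ballot).

open import Defs
open import Data.Empty using (⊥; ⊥-elim)
open import Data.Fin.Base using (toℕ; fromℕ<)
open import Data.Fin.Properties using (toℕ<n)
open import Data.Integer.Base as ℤ using (_⊖_; 0ℤ; -1ℤ; ∣_∣) renaming (+_ to pos)
open import Data.Integer.Properties as ℤₚ using ([1+m]⊖[1+n]≡m⊖n)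
open import Data.List.Base using (List; []; _∷_; _++_; length; inits)
open import Data.List.Membership.Propositional using (_∈_)
open import Data.List.Membership.Propositional.Properties using (∈-++⁺ˡ; ∈-++⁺ʳ; ∈-++⁻)
open import Data.List.Properties
  using (++-assoc; ++-cancelˡ; ∷-injectiveˡ; ∷-injectiveʳ; length-++)
open import Data.List.Relation.Binary.Pointwise using (Pointwise; []; _∷_; Pointwise-length)
open import Data.List.Relation.Unary.All as All using (All; []; _∷_)
import Data.List.Relation.Unary.All.Properties as Allₚ
open import Data.List.Relation.Unary.AllPairs using ([]; _∷_)
open import Data.List.Relation.Unary.Any using (here; there)
open import Data.List.Relation.Unary.Unique.Propositional using (Unique)
open import Data.List.Relation.Unary.Unique.Propositional.Properties using (++⁺)
open import Data.Nat.Base as ℕ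
  using (ℕ; zero; suc; _+_; _*_; _∸_; _≤_; _<_; z≤n; s≤s)
open import Data.Nat.Properties as ℕₚ using (_<?_)
open import Data.Nat.Solver using (module +-*-Solver)
open import Data.Product.Base using (_×_; _,_; ∃-syntax; proj₁; proj₂)
open import Data.Sum.Base as Sum using (_⊎_; inj₁; inj₂)
open import Data.Unit.Base using (⊤; tt)
open import Function.Base using (_∘_; id)
open import Function.Bundles using (mk⇔; Equivalence)
open import Relation.Binary.Construct.Closure.ReflexiveTransitive
  using (Star; ε; _◅_; _◅◅_; gmap)
open import Relation.Binary.PropositionalEquality
  using (_≡_; _≢_; refl; sym; trans; cong; cong₂; subst; subst₂; module ≡-Reasoning)
open import Relation.Nullary using (¬_; yes; no)
open Equivalence using (to; from)

-- Words and lattice paths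

Word : Set
Word = List Step

#u-++ : ∀ v w → #u (v ++ w) ≡ #u v + #u w
#u-++ []      w = refl
#u-++ (u ∷ v) w = cong suc (#u-++ v w)
#u-++ (d ∷ v) w = #u-++ v w

#d-++ : ∀ v w → #d (v ++ w) ≡ #d v + #d w
#d-++ []      w = refl
#d-++ (u ∷ v) w = #d-++ v w
#d-++ (d ∷ v) w = cong suc (#d-++ v w)

++-length-unique : ∀ (v v′ : Word) {w w′} → v ++ w ≡ v′ ++ w′ → length v ≡ length v′ → v ≡ v′
++-length-unique []      []       _ _ = refl
++-length-unique (x ∷ v) (y ∷ v′) e l =
  cong₂ _∷_ (∷-injectiveˡ e) (++-length-unique v v′ (∷-injectiveʳ e) (ℕₚ.suc-injective l))

-- Two words that start to differ at a down and an up step determine their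
-- common prefix.
common-prefix : ∀ (A A′ : Word) {v v′ w w′} → A ++ d ∷ v ≡ A′ ++ d ∷ v′ → A ++ u ∷ w ≡ A′ ++ u ∷ w′ →
  A ≡ A′ × v ≡ v′ × w ≡ w′
common-prefix []      []       refl refl = refl , refl , refl
common-prefix []      (u ∷ A′) ()   f
common-prefix []      (d ∷ A′) e    ()
common-prefix (u ∷ A) []       ()   f
common-prefix (d ∷ A) []       e    ()
common-prefix (x ∷ A) (y ∷ A′) e    f
  with refl ← ∷-injectiveˡ e
  with refl , e′ , f′ ← common-prefix A A′ (∷-injectiveʳ e) (∷-injectiveʳ f) = refl , e′ , f′

shorter : ∀ {n} (X : Word) {B : Word} → length (X ++ B) < n → length B < n
shorter X lt = ℕₚ.≤-<-trans (length-suffix X) lt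
  where
  length-suffix : ∀ (X : Word) {B : Word} → length B ≤ length (X ++ B)
  length-suffix []      = ℕₚ.≤-refl
  length-suffix (_ ∷ X) = ℕₚ.m≤n⇒m≤1+n (length-suffix X)

-- d^ k w is w preceded by k down steps.
d^ : ℕ → Word → Word
d^ zero    w = w
d^ (suc k) w = d ∷ d^ k w

d^-comm : ∀ k w → d^ k (d ∷ w) ≡ d ∷ d^ k w
d^-comm zero    w = refl
d^-comm (suc k) w = cong (d ∷_) (d^-comm k w)

#u-d^ : ∀ k w → #u (d^ k w) ≡ #u w
#u-d^ zero    w = refl
#u-d^ (suc k) w = #u-d^ k w

#d-d^ : ∀ k w → #d (d^ k w) ≡ k + #d w
#d-d^ zero    w = refl
#d-d^ (suc k) w = cong suc (#d-d^ k w)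

-- Path h w m: starting from level h, the word w leads to level m without
-- going below level 0.  Dyck paths are the w with Path 0 w 0.
data Path : ℕ → Word → ℕ → Set where
  []   : ∀ {h} → Path h [] h
  up   : ∀ {h w m} → Path (suc h) w m → Path h (u ∷ w) m
  down : ∀ {h w m} → Path h w m → Path (suc h) (d ∷ w) m

path-++ : ∀ {h v m w n} → Path h v m → Path m w n → Path h (v ++ w) n
path-++ []       y = y
path-++ (up x)   y = up (path-++ x y)
path-++ (down x) y = down (path-++ x y)

path-split : ∀ {h n} v {w} → Path h (v ++ w) n → ∃[ m ] Path h v m × Path m w n
path-split []      x        = _ , [] , x
path-split (u ∷ v) (up x)   with m , y , z ← path-split v x = m , up y , z
path-split (d ∷ v) (down x) with m , y , z ← path-split v x = m , down y , z

path-raise : ∀ {h w m} → Path h w m → Path (suc h) w (suc m)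
path-raise []       = []
path-raise (up p)   = up (path-raise p)
path-raise (down p) = down (path-raise p)

path-d^ : ∀ k {h w m} → Path h w m → Path (k + h) (d^ k w) m
path-d^ zero    p = p
path-d^ (suc k) p = down (path-d^ k p)

path-d^⁻ : ∀ k {h w m} → Path h (d^ k w) m → ∃[ r ] h ≡ k + r × Path r w m
path-d^⁻ zero    p = _ , refl , p
path-d^⁻ (suc k) (down p) with r , refl , q ← path-d^⁻ k p = r , refl , q

path-end : ∀ {g w m n} → Path g w m → Path g w n → m ≡ n
path-end []       []       = refl
path-end (up p)   (up q)   = path-end p q
path-end (down p) (down q) = path-end p q

path-raise^ : ∀ k {h w m} → Path h w m → Path (h + k) w (m + k)
path-raise^ k []       = []
path-raise^ k (up p)   = up (path-raise^ k p)
path-raise^ k (down p) = down (path-raise^ k p)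

path-balance : ∀ {h w m} → Path h w m → #u w + h ≡ #d w + m
path-balance [] = refl
path-balance {h} {u ∷ w} (up p) = trans (sym (ℕₚ.+-suc (#u w) h)) (path-balance p)
path-balance {suc h} {d ∷ w} (down p) = trans (ℕₚ.+-suc (#u w) h) (cong suc (path-balance p))

infixl 5 _▹_

-- i ▹ w is the number of up steps seen after reading w when i were seen before.
_▹_ : ℕ → Word → ℕ
i ▹ []      = i
i ▹ (u ∷ w) = suc i ▹ w
i ▹ (d ∷ w) = i ▹ w

▹-++ : ∀ i v w → i ▹ (v ++ w) ≡ i ▹ v ▹ w
▹-++ i []      w = refl
▹-++ i (u ∷ v) w = ▹-++ (suc i) v w
▹-++ i (d ∷ v) w = ▹-++ i v w

▹-#u : ∀ i w → i ▹ w ≡ #u w + i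
▹-#u i []      = refl
▹-#u i (u ∷ w) = trans (▹-#u (suc i) w) (ℕₚ.+-suc (#u w) i)
▹-#u i (d ∷ w) = ▹-#u i w

-- Rotations of words

-- Throughout, δ i is the value of the up step preceded by i other up steps in
-- the whole path, and judgements on a word carry the number i of up steps before
-- it.
module Rotations (δ : ℕ → ℕ) (δ≤1 : ∀ i → δ i ≤ 1) where

  private variable
    i k l m : ℕ
    A B C p q v w X Y Z S T : Word

  -- Pays i l X: starting from δ-level l, where an up step adds its value and a
  -- down step subtracts 1, the word X reaches level 0 at its end and not before.
  data Pays : ℕ → ℕ → Word → Set where
    done : Pays i 0 []
    up   : Pays (suc i) (δ i + suc l) w → Pays i (suc l) (u ∷ w)
    down : Pays i l w → Pays i (suc l) (d ∷ w)

  -- The word u X is an excursion.  Its opening up step is left out, since X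
  -- is what the recursions work on; Pays starts at the level δ i reached after it.
  Exc : ℕ → Word → Set
  Exc i X = Pays (suc i) (δ i) X

  pays-level : k ≡ l → Pays i k X → Pays i l X
  pays-level refl x = x

  pays-++ : Pays i l X → Pays (i ▹ X) m Y → Pays i (l + m) (X ++ Y)
  pays-++ done     y = y
  pays-++ {i} {suc l} {m = m} (up x) y =
    up (pays-level (ℕₚ.+-assoc (δ i) (suc l) m) (pays-++ x y))
  pays-++ (down x) y = down (pays-++ x y)

  -- Cut at the first visit of level m.
  pays-split : ∀ l → Pays i k Z → k ≡ l + m →
    ∃[ X ] ∃[ Y ] Z ≡ X ++ Y × Pays i l X × Pays (i ▹ X) m Y
  pays-split zero z refl = [] , _ , refl , done , z
  pays-split {i = i} {m = m} (suc l) (up {l = k} z) eq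
    with X , Y , refl , x , y ← pays-split (δ i + suc l) z
           (trans (cong (λ n → δ i + n) eq) (sym (ℕₚ.+-assoc (δ i) (suc l) m))) =
    u ∷ X , Y , refl , up x , y
  pays-split (suc l) (down z) eq
    with X , Y , refl , x , y ← pays-split l z (ℕₚ.suc-injective eq) =
    d ∷ X , Y , refl , down x , y

  -- No word that pays for l is a proper prefix of another one.
  pays-unique : ∀ {X′ Y′} → Pays i l X → Pays i l X′ → X ++ Y ≡ X′ ++ Y′ → X ≡ X′ × Y ≡ Y′
  pays-unique done     done     eq = refl , eq
  pays-unique (up x)   (up x′) eq
    with refl , e ← pays-unique x x′ (∷-injectiveʳ eq) = refl , e
  pays-unique (down x) (down x′) eq
    with refl , e ← pays-unique x x′ (∷-injectiveʳ eq) = refl , e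

  infix 4 _⊢_⟶_ _⊢_⟶*_

  -- i ⊢ v ⟶ w: the word w is a rotation of v.  The equations in here keep
  -- appended words out of the indices, so that words can be analysed letter by
  -- letter.
  data _⊢_⟶_ : ℕ → Word → Word → Set where
    here : Exc i X → p ≡ X ++ B → q ≡ X ++ d ∷ B → i ⊢ d ∷ u ∷ p ⟶ u ∷ q
    up   : suc i ⊢ v ⟶ w → i ⊢ u ∷ v ⟶ u ∷ w
    down : i ⊢ v ⟶ w → i ⊢ d ∷ v ⟶ d ∷ w

  _⊢_⟶*_ : ℕ → Word → Word → Set
  i ⊢ v ⟶* w = Star (i ⊢_⟶_) v w

  rotate : Exc i X → i ⊢ d ∷ u ∷ X ++ B ⟶* u ∷ X ++ d ∷ B
  rotate x = here x refl refl ◅ ε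

  ⟶-prefix : ∀ A → i ▹ A ⊢ v ⟶ w → i ⊢ A ++ v ⟶ A ++ w
  ⟶-prefix []      r = r
  ⟶-prefix (u ∷ A) r = up (⟶-prefix A r)
  ⟶-prefix (d ∷ A) r = down (⟶-prefix A r)

  prefix : ∀ A → i ▹ A ⊢ v ⟶* w → i ⊢ A ++ v ⟶* A ++ w
  prefix A = gmap (A ++_) (⟶-prefix A)

  ⟶-d^ : ∀ k → i ⊢ v ⟶ w → i ⊢ d^ k v ⟶ d^ k w
  ⟶-d^ zero    r = r
  ⟶-d^ (suc k) r = down (⟶-d^ k r)

  prefix-d^ : ∀ k → i ⊢ v ⟶* w → i ⊢ d^ k v ⟶* d^ k w
  prefix-d^ k = gmap (d^ k) (⟶-d^ k)

  ⟶-suffix : i ⊢ v ⟶ w → i ⊢ v ++ Z ⟶ w ++ Z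
  ⟶-suffix {Z = Z} (here {X = X} {B = B} x refl refl) =
    here x (++-assoc X B Z) (++-assoc X (d ∷ B) Z)
  ⟶-suffix (up r)   = up (⟶-suffix r)
  ⟶-suffix (down r) = down (⟶-suffix r)

  suffix : i ⊢ v ⟶* w → i ⊢ v ++ Z ⟶* w ++ Z
  suffix = gmap (_++ _) ⟶-suffix

  ⟶-last : ∀ k → Exc i X → i ⊢ d^ (suc k) (u ∷ X ++ B) ⟶ d^ k (u ∷ X ++ d ∷ B)
  ⟶-last zero    x = here x refl refl
  ⟶-last (suc k) x = down (⟶-last k x)

  rotate-last : ∀ k → Exc i X → i ⊢ d^ (suc k) (u ∷ X ++ B) ⟶* d^ k (u ∷ X ++ d ∷ B)
  rotate-last k x = ⟶-last k x ◅ ε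

  -- Leading letters

  -- A leading up step is never lost.  Hence leading letters common to the two
  -- ends of an interval are shared by all its elements, and can be cancelled.
  starts-u : i ⊢ u ∷ v ⟶* w → ∃[ w′ ] w ≡ u ∷ w′ × suc i ⊢ v ⟶* w′
  starts-u ε = _ , refl , ε
  starts-u (up r ◅ rs) with w′ , refl , s ← starts-u rs = w′ , refl , r ◅ s

  cancel-u : i ⊢ u ∷ v ⟶* u ∷ w → suc i ⊢ v ⟶* w
  cancel-u s with _ , refl , s′ ← starts-u s = s′

  u↛d : ¬ (i ⊢ u ∷ v ⟶* d ∷ w)
  u↛d s with starts-u s
  ... | _ , () , _

  cancel-d : i ⊢ d ∷ v ⟶* d ∷ w → i ⊢ v ⟶* w
  cancel-d ε                  = ε
  cancel-d (here _ _ _ ◅ rs) = ⊥-elim (u↛d rs)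
  cancel-d (down r ◅ rs)      = r ◅ cancel-d rs

  cancel-d^ : ∀ k → i ⊢ d^ k v ⟶* d^ k w → i ⊢ v ⟶* w
  cancel-d^ zero    s = s
  cancel-d^ (suc k) s = cancel-d^ k (cancel-d s)

  drop-d^ : ∀ k → i ⊢ d^ (suc k) v ⟶* d^ k w → i ⊢ d ∷ v ⟶* w
  drop-d^ zero    s = s
  drop-d^ (suc k) s = drop-d^ k (cancel-d s)

  d^u↛d^suc : ∀ k → ¬ (i ⊢ d^ k (u ∷ v) ⟶* d^ (suc k) w)
  d^u↛d^suc zero    s = u↛d s
  d^u↛d^suc (suc k) s = d^u↛d^suc k (cancel-d s)

  cancel : ∀ A → i ⊢ A ++ v ⟶* A ++ w → i ▹ A ⊢ v ⟶* w
  cancel []      s = s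
  cancel (u ∷ A) s = cancel A (cancel-u s)
  cancel (d ∷ A) s = cancel A (cancel-d s)

  prefix-kept : ∀ A → i ⊢ A ++ v ⟶* w → i ⊢ w ⟶* A ++ Z → ∃[ w′ ] w ≡ A ++ w′
  prefix-kept []      _ _ = _ , refl
  prefix-kept (u ∷ A) s t with _ , refl , s′ ← starts-u s
    with w′ , refl ← prefix-kept A s′ (cancel-u t) = w′ , refl
  prefix-kept {w = d ∷ w} (d ∷ A) s t
    with w′ , refl ← prefix-kept A (cancel-d s) (cancel-d t) = w′ , refl
  prefix-kept {w = u ∷ w} (d ∷ A) s t = ⊥-elim (u↛d t)
  prefix-kept {w = []} (d ∷ A) s (() ◅ t)

  -- A leading down step disappears at a definite rotation, over an excursion
  -- u X.
  split-d : i ⊢ d ∷ p ⟶* u ∷ q →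
    ∃[ X ] ∃[ B ] Exc i X × i ⊢ p ⟶* u ∷ X ++ B × i ⊢ u ∷ X ++ d ∷ B ⟶* u ∷ q
  split-d (here x refl refl ◅ rs) = _ , _ , x , ε , rs
  split-d (down r ◅ rs) with X , B , x , s , t ← split-d rs = X , B , x , r ◅ s , t

  -- Antisymmetry and invariants

  ⟶-inv : ∀ j → i ⊢ v ⟶ w → inv j w < inv j v
  ⟶-inv j (here {X = X} {B = B} _ refl refl) = inv-rotate j [] X B
  ⟶-inv j (up r)   = ℕₚ.+-monoʳ-< j (⟶-inv j r)
  ⟶-inv j (down r) = ⟶-inv (suc j) r

  ⟶*-inv : i ⊢ v ⟶* w → inv 0 w ≤ inv 0 v
  ⟶*-inv ε        = ℕₚ.≤-refl
  ⟶*-inv (r ◅ rs) = ℕₚ.≤-trans (⟶*-inv rs) (ℕₚ.<⇒≤ (⟶-inv 0 r))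

  ⟶-irrefl : i ⊢ v ⟶ w → ¬ (i ⊢ w ⟶* v)
  ⟶-irrefl r s = ℕₚ.<-irrefl refl (ℕₚ.≤-<-trans (⟶*-inv s) (⟶-inv 0 r))

  antisym : i ⊢ v ⟶* w → i ⊢ w ⟶* v → v ≡ w
  antisym ε        _ = refl
  antisym (r ◅ rs) s = ⊥-elim (⟶-irrefl r (rs ◅◅ s))

  ⟶-#u : i ⊢ v ⟶ w → #u v ≡ #u w
  ⟶-#u (here {X = X} {B = B} _ refl refl) = cong suc (trans (#u-++ X B) (sym (#u-++ X (d ∷ B))))
  ⟶-#u (up r)   = cong suc (⟶-#u r)
  ⟶-#u (down r) = ⟶-#u r

  ⟶*-#u : i ⊢ v ⟶* w → #u v ≡ #u w
  ⟶*-#u ε        = refl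
  ⟶*-#u (r ◅ rs) = trans (⟶-#u r) (⟶*-#u rs)

  ⟶*-▹ : ∀ j → i ⊢ v ⟶* w → j ▹ v ≡ j ▹ w
  ⟶*-▹ {v = v} {w} j s = trans (▹-#u j v) (trans (cong (_+ j) (⟶*-#u s)) (sym (▹-#u j w)))

  -- Evolution of an opening excursion

  -- The rotations of d w either move the leading down step or take place in w.
  rotation-d : i ⊢ d ∷ w ⟶ v →
    (∃[ X ] ∃[ B ] Exc i X × w ≡ u ∷ X ++ B × v ≡ u ∷ X ++ d ∷ B) ⊎
    (∃[ w′ ] v ≡ d ∷ w′ × i ⊢ w ⟶ w′)
  rotation-d (here x refl refl) = inj₁ (_ , _ , x , refl , refl)
  rotation-d (down r)           = inj₂ (_ , refl , r)

  -- The three kinds of rotations v of C X, when C pays for l: inside C, inside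
  -- X, and moving the last letter of C over an excursion at the start of X.
  data StepSplit (i l : ℕ) (C X v : Word) : Set where
    inside : ∀ {C′} → i ⊢ C ⟶ C′ → Pays i l C′ → v ≡ C′ ++ X → StepSplit i l C X v
    after  : ∀ {X′} → i ▹ C ⊢ X ⟶ X′ → v ≡ C ++ X′ → StepSplit i l C X v
    cross  : ∀ {C₀ Y B} → C ≡ C₀ ++ d ∷ [] → X ≡ u ∷ Y ++ B → Exc (i ▹ C₀) Y →
             Pays i l (C₀ ++ u ∷ Y ++ d ∷ []) → v ≡ C₀ ++ u ∷ Y ++ d ∷ B →
             StepSplit i l C X v

  step-split : Pays i l C → i ⊢ C ++ X ⟶ v → StepSplit i l C X v
  step-split done r = after r refl
  step-split (up c) (up r) with step-split c r
  ... | inside r′ c′ refl        = inside (up r′) (up c′) refl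
  ... | after r′ refl            = after r′ refl
  ... | cross refl refl y c′ refl = cross {C₀ = u ∷ _} refl refl y (up c′) refl
  step-split (down c) r with rotation-d r
  ... | inj₂ (_ , refl , r₁) with step-split c r₁
  ...   | inside r′ c′ refl         = inside (down r′) (down c′) refl
  ...   | after r′ refl             = after r′ refl
  ...   | cross refl refl y c′ refl = cross {C₀ = d ∷ _} refl refl y (down c′) refl
  step-split (down done) r | inj₁ (Y , _ , y , refl , refl) =
    cross {C₀ = []} refl refl y (up (pays-++ y (down done))) refl
  step-split {i = i} {X = X} (down (up c)) r | inj₁ (Y , B , y , eq , refl)
    with Y′ , Z , refl , y′ , z ← pays-split (δ i) c refl
    with refl , refl ← pays-unique y y′ (trans (sym (∷-injectiveʳ eq)) (++-assoc Y′ Z X)) =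
    inside (here y refl refl) (up (pays-++ y (down z))) (cong (u ∷_) (sym (++-assoc Y (d ∷ Z) X)))

  -- A path of rotations from C X to v which at some moment moves the last
  -- letter of the first part over an excursion u Y; the rotated word is the source
  -- of the last field.
  data Crossing (i l : ℕ) (C X v : Word) : Set where
    crossing : ∀ {C₀ Y B} → i ⊢ C ⟶* C₀ ++ d ∷ [] → Pays i l (C₀ ++ d ∷ []) →
               i ▹ C ⊢ X ⟶* u ∷ Y ++ B → Exc (i ▹ C₀) Y →
               i ⊢ C₀ ++ u ∷ Y ++ d ∷ B ⟶* v → Crossing i l C X v

  -- What C X, with C paying for l, may become: the two parts evolve separately,
  -- or the part paying for l has gained up steps in a crossing.
  data Follow (i l : ℕ) (C X v : Word) : Set where
    parallel : ∀ {C′ X′} → v ≡ C′ ++ X′ → Pays i l C′ →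
               i ⊢ C ⟶* C′ → i ▹ C ⊢ X ⟶* X′ → Follow i l C X v
    longer   : ∀ {C′ X′} → v ≡ C′ ++ X′ → Pays i l C′ →
               #u C < #u C′ → Crossing i l C X v → Follow i l C X v

  #u-cross : ∀ C₀ Y → #u (C₀ ++ d ∷ []) < #u (C₀ ++ u ∷ Y ++ d ∷ [])
  #u-cross C₀ Y rewrite #u-++ C₀ (d ∷ []) | #u-++ C₀ (u ∷ Y ++ d ∷ []) = ℕₚ.+-monoʳ-< (#u C₀) (s≤s z≤n)

  cross-assoc : ∀ C₀ Y B → C₀ ++ u ∷ Y ++ d ∷ B ≡ (C₀ ++ u ∷ Y ++ d ∷ []) ++ B
  cross-assoc C₀ Y B = sym (trans (++-assoc C₀ _ B) (cong (λ w → C₀ ++ u ∷ w) (++-assoc Y _ B)))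

  follow : Pays i l C → w ≡ C ++ X → i ⊢ w ⟶* v → Follow i l C X v
  follow c eq ε = parallel eq c ε ε
  follow c refl (r ◅ rs) with step-split c r
  ... | inside {C′} r′ c′ refl with e ← ⟶*-▹ {w = C′} _ (r′ ◅ ε) | follow c′ refl rs
  ...   | parallel refl c″ s t = parallel refl c″ (r′ ◅ s) (subst (_⊢ _ ⟶* _) (sym e) t)
  ...   | longer refl c″ lt (crossing a b t y z) =
          longer refl c″ (subst (_< _) (sym (⟶-#u r′)) lt)
            (crossing (r′ ◅ a) b (subst (_⊢ _ ⟶* _) (sym e) t) y z)
  follow c refl (r ◅ rs) | after r′ refl with follow c refl rs
  ...   | parallel refl c″ s t = parallel refl c″ s (r′ ◅ t)
  ...   | longer refl c″ lt (crossing a b t y z) = longer refl c″ lt (crossing a b (r′ ◅ t) y z)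
  follow c refl (r ◅ rs) | cross {C₀} {Y} {B} refl refl y c′ refl
    with follow c′ (cross-assoc C₀ Y B) rs
  ...   | parallel e c″ s _ =
          longer e c″ (subst (#u (C₀ ++ d ∷ []) <_) (⟶*-#u s) (#u-cross C₀ Y)) (crossing ε c ε y rs)
  ...   | longer e c″ lt _  = longer e c″ (ℕₚ.<-trans (#u-cross C₀ Y) lt) (crossing ε c ε y rs)

  -- A down step inserted right after the part paying for l does no harm: if a
  -- rotation moves the last letter of that part over an excursion, the inserted
  -- one follows in a second rotation.
  insert-d : Pays i l C → Pays i l Z → w ≡ C ++ X → i ⊢ w ⟶* Z ++ Y → i ⊢ C ++ d ∷ X ⟶* Z ++ d ∷ Y
  insert-d c z eq ε with refl , refl ← pays-unique z c eq = ε
  insert-d c z refl (r ◅ rs) with step-split c r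
  ... | inside r′ c′ refl = ⟶-suffix r′ ◅ insert-d c′ z refl rs
  ... | after r′ refl     = ⟶-prefix _ (down r′) ◅ insert-d c z refl rs
  ... | cross {C₀} {Y} {B} refl refl y c′ refl =
    subst₂ (_ ⊢_⟶*_) (sym (++-assoc C₀ (d ∷ []) _)) (cross-assoc C₀ Y (d ∷ B))
      (prefix C₀ (gmap (d ∷_) down (rotate y) ◅◅ rotate y))
    ◅◅ insert-d c′ z (cross-assoc C₀ Y B) rs

  insert-d-exc : Exc i X → Exc i Y → i ⊢ u ∷ X ++ B ⟶* u ∷ Y ++ C → i ⊢ u ∷ X ++ d ∷ B ⟶* u ∷ Y ++ d ∷ C
  insert-d-exc x y s = prefix (u ∷ []) (insert-d x y refl (cancel-u s))

  ↛[] : ∀ {x} → ¬ (i ⊢ x ∷ w ⟶* [])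
  ↛[] (here _ _ _ ◅ rs) = ↛[] rs
  ↛[] (up _ ◅ rs)       = ↛[] rs
  ↛[] (down _ ◅ rs)     = ↛[] rs

  -- Rotating the leading down step at once is the least way to reach a word
  -- that starts with an up step.
  jump : Exc i X → i ⊢ d ∷ u ∷ X ++ B ⟶* u ∷ q → i ⊢ u ∷ X ++ d ∷ B ⟶* u ∷ q
  jump x s with _ , _ , y , s₁ , s₂ ← split-d s = insert-d-exc x y s₁ ◅◅ s₂

  -- Above d^(m+1) u X B, either all the leading down steps are still there, or
  -- the last of them may as well be rotated at once.
  jump^ : ∀ m → Exc i X → i ⊢ d^ (suc m) (u ∷ X ++ B) ⟶* w →
    (∃[ v ] w ≡ d^ (suc m) v × i ⊢ u ∷ X ++ B ⟶* v) ⊎ i ⊢ d^ m (u ∷ X ++ d ∷ B) ⟶* w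
  jump^ {w = []} m x s = ⊥-elim (↛[] s)
  jump^ {w = d ∷ w} zero x s = inj₁ (w , refl , cancel-d s)
  jump^ {w = u ∷ w} zero x s = inj₂ (jump x s)
  jump^ {w = d ∷ w} (suc m) x s with jump^ m x (cancel-d s)
  ... | inj₁ (v , refl , t) = inj₁ (v , refl , t)
  ... | inj₂ t              = inj₂ (prefix (d ∷ []) t)
  jump^ {w = u ∷ w} (suc m) x s with _ , _ , y , s₁ , s₂ ← split-d s | jump^ m x s₁
  ... | inj₁ (_ , () , _)
  ... | inj₂ t = inj₂ (prefix (d ∷ []) t ◅◅ rotate y ◅◅ s₂)

  -- The opening excursion behind some leading down steps can only gain up
  -- steps; if it gains none, it and the rest evolve separately.
  passes : ∀ k → Exc i X → Exc i Y → i ⊢ d^ k (u ∷ X ++ B) ⟶* u ∷ Y ++ C →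
    (suc i ⊢ X ⟶* Y × suc i ▹ X ⊢ d^ k B ⟶* C) ⊎ #u X < #u Y
  passes zero x y s with follow x refl (cancel-u s)
  ... | parallel eq y′ a b with refl , refl ← pays-unique y y′ eq = inj₁ (a , b)
  ... | longer eq y′ lt _  with refl , refl ← pays-unique y y′ eq = inj₂ lt
  passes (suc k) x y s with _ , _ , z , s₁ , s₂ ← split-d s | passes k x z s₁ | passes zero z y s₂
  ... | inj₁ (a , b) | inj₁ (a′ , b′) =
        inj₁ (a ◅◅ a′ , prefix (d ∷ []) b ◅◅ subst (_⊢ _ ⟶* _) (sym (⟶*-▹ _ a)) b′)
  ... | inj₁ (a , _) | inj₂ lt = inj₂ (subst (_< _) (sym (⟶*-#u a)) lt)
  ... | inj₂ lt | inj₁ (a , _) = inj₂ (subst (_ <_) (⟶*-#u a) lt)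
  ... | inj₂ lt | inj₂ lt′     = inj₂ (ℕₚ.<-trans lt lt′)

  -- By the first hypothesis the opening excursion of v has at least as many up
  -- steps as u X, by the second one at most as many; so it is u X.
  pinch : ∀ k → Exc i X → i ⊢ u ∷ X ++ B ⟶* v → i ⊢ d^ k v ⟶* u ∷ X ++ C →
    ∃[ B′ ] v ≡ u ∷ X ++ B′ × suc i ▹ X ⊢ B ⟶* B′ × suc i ▹ X ⊢ d^ k B′ ⟶* C
  pinch k x s t with _ , refl , s′ ← starts-u s | follow x refl s′
  ... | parallel refl y a b with passes k y x t
  ...   | inj₂ lt = ⊥-elim (ℕₚ.<-irrefl (sym (⟶*-#u a)) lt)
  ...   | inj₁ (a′ , b′) with refl ← antisym a a′ = _ , refl , b , b′
  pinch k x s t | longer refl y lt _ with passes k y x t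
  ...   | inj₂ lt′     = ⊥-elim (ℕₚ.<-asym lt lt′)
  ...   | inj₁ (a′ , _) = ⊥-elim (ℕₚ.<-irrefl (sym (⟶*-#u a′)) lt)

  -- In the right interval above d^k u X B, only the bottom starts with k down
  -- steps.
  stay : ∀ k → Exc i X → i ⊢ u ∷ X ++ B ⟶* v → i ⊢ d^ k v ⟶* u ∷ X ++ d^ k B → v ≡ u ∷ X ++ B
  stay k x s t with B′ , refl , a , b ← pinch k x s t with refl ← antisym a (cancel-d^ k b) = refl

  -- Intervals that are chains

  -- Excs i k S T: the word S is a sequence of k consecutive excursions, and T
  -- is S without the k up steps that open them.
  data Excs : ℕ → ℕ → Word → Word → Set where
    []  : Excs i 0 [] []
    _∷_ : Exc i X → Excs (suc i ▹ X) k S T → Excs i (suc k) (u ∷ X ++ S) (X ++ T)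

  -- In the left interval above d S B, only the bottom starts with a down step.
  stay-excs : Excs i k S T → i ⊢ S ++ B ⟶* v → i ⊢ d ∷ v ⟶* S ++ d ∷ B → v ≡ S ++ B
  stay-excs [] s t = sym (antisym s (cancel-d t))
  stay-excs {B = B} (_∷_ {X = X} {S = S} x xs) s t
    rewrite ++-assoc X S B | ++-assoc X S (d ∷ B)
    with B′ , refl , a , b ← pinch 1 x s t with refl ← stay-excs xs a b = refl

  -- Lin i k p q: the interval [p , q] is a chain of k rotations.  At each step,
  -- v is the least element other than the bottom p.
  data Lin (i : ℕ) : ℕ → Word → Word → Set where
    nil  : Lin i 0 p p
    cons : i ⊢ p ⟶ v →
           (∀ w → i ⊢ p ⟶* w → i ⊢ w ⟶* q → w ≡ p ⊎ i ⊢ v ⟶* w) →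
           Lin i k v q → Lin i (suc k) p q

  lin-prefix : ∀ A → Lin (i ▹ A) k p q → Lin i k (A ++ p) (A ++ q)
  lin-prefix A nil = nil
  lin-prefix {i} {p = p} {q} A (cons {v = v} r f l) = cons (⟶-prefix A r) g (lin-prefix A l)
    where
    g : ∀ w → i ⊢ A ++ p ⟶* w → i ⊢ w ⟶* A ++ q → w ≡ A ++ p ⊎ i ⊢ A ++ v ⟶* w
    g w s t with w′ , refl ← prefix-kept A s t with f w′ (cancel A s) (cancel A t)
    ... | inj₁ refl = inj₁ refl
    ... | inj₂ s′   = inj₂ (prefix A s′)

  lin⇒⟶* : Lin i k p q → i ⊢ p ⟶* q
  lin⇒⟶* nil          = ε
  lin⇒⟶* (cons r _ l) = r ◅ lin⇒⟶* l

  -- The chain d S B, ..., S d B in which the down step jumps over the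
  -- excursions of S one after the other.
  left-lin : Excs i k S T → Lin i k (d ∷ S ++ B) (S ++ d ∷ B)
  left-lin [] = nil
  left-lin {i} {B = B} (_∷_ {X = X} {S = S} x xs) =
    cons (here x (++-assoc X S B) refl) g
      (subst (Lin _ _ _) (sym (++-assoc (u ∷ X) S (d ∷ B))) (lin-prefix (u ∷ X) (left-lin xs)))
    where
    g : ∀ w → i ⊢ d ∷ (u ∷ X ++ S) ++ B ⟶* w → i ⊢ w ⟶* (u ∷ X ++ S) ++ d ∷ B →
        w ≡ d ∷ (u ∷ X ++ S) ++ B ⊎ i ⊢ u ∷ X ++ d ∷ S ++ B ⟶* w
    g w s t with jump^ {B = S ++ B} 0 x (subst (λ Z → i ⊢ d ∷ u ∷ Z ⟶* w) (++-assoc X S B) s)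
    ... | inj₂ s′ = inj₂ s′
    ... | inj₁ (v , refl , _) = inj₁ (cong (d ∷_) (stay-excs (x ∷ xs) (cancel-d s) t))

  -- The chain d^k u X B, ..., u X d^k B in which the excursion u X passes
  -- the down steps one after the other.
  right-lin : ∀ k → Exc i X → Lin i k (d^ k (u ∷ X ++ B)) (u ∷ X ++ d^ k B)
  right-lin zero x = nil
  right-lin {i} {X} {B} (suc k) x =
    cons (⟶-last k x) g
      (subst (λ Z → Lin i k (d^ k (u ∷ X ++ d ∷ B)) (u ∷ X ++ Z)) (d^-comm k B) (right-lin k x))
    where
    g : ∀ w → i ⊢ d^ (suc k) (u ∷ X ++ B) ⟶* w → i ⊢ w ⟶* u ∷ X ++ d^ (suc k) B →
        w ≡ d^ (suc k) (u ∷ X ++ B) ⊎ i ⊢ d^ k (u ∷ X ++ d ∷ B) ⟶* w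
    g w s t with jump^ k x s
    ... | inj₂ s′ = inj₂ s′
    ... | inj₁ (v , refl , s′) = inj₁ (cong (d^ (suc k)) (stay (suc k) x s′ t))

  left-sweep : Excs i k S T → i ⊢ d ∷ S ++ B ⟶* S ++ d ∷ B
  left-sweep xs = lin⇒⟶* (left-lin xs)

  right-sweep : ∀ k → Exc i X → i ⊢ d^ k (u ∷ X ++ B) ⟶* u ∷ X ++ d^ k B
  right-sweep k x = lin⇒⟶* (right-lin k x)

  -- Values are at most 1, so the δ-level decreases at least as fast as the
  -- level of the path and reaches 0 if it starts no higher.
  pays-exists : ∀ {h} → Path h w 0 → l ≤ h → ∃[ X ] ∃[ Y ] w ≡ X ++ Y × Pays i l X
  pays-exists {l = zero} p _ = [] , _ , refl , done
  pays-exists {l = suc l} {i = i} (up p) l≤h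
    with X , Y , refl , x ← pays-exists p (ℕₚ.+-mono-≤ (δ≤1 i) l≤h) = u ∷ X , Y , refl , up x
  pays-exists {l = suc l} (down p) (s≤s l≤h)
    with X , Y , refl , x ← pays-exists p l≤h = d ∷ X , Y , refl , down x

  pays-cross : ∀ C → Pays i l (C ++ d ∷ []) → Exc (i ▹ C) Y → Pays i l (C ++ u ∷ Y ++ d ∷ [])
  pays-cross []      (down done) y = up (pays-++ y (down done))
  pays-cross (u ∷ C) (up c)      y = up (pays-cross C c y)
  pays-cross (d ∷ C) (down c)    y = down (pays-cross C c y)

  rotation-d^ : ∀ m → i ⊢ d^ (suc m) w ⟶ v →
    (∃[ w′ ] v ≡ d^ (suc m) w′ × i ⊢ w ⟶ w′) ⊎
    (∃[ X ] ∃[ B ] Exc i X × w ≡ u ∷ X ++ B × v ≡ d^ m (u ∷ X ++ d ∷ B))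
  rotation-d^ m r with rotation-d r
  rotation-d^ zero    r | inj₁ z = inj₂ z
  rotation-d^ zero    r | inj₂ z = inj₁ z
  rotation-d^ (suc m) r | inj₁ (_ , _ , _ , () , _)
  rotation-d^ (suc m) r | inj₂ (_ , refl , r′) with rotation-d^ m r′
  ... | inj₁ (w , refl , t)             = inj₁ (w , refl , t)
  ... | inj₂ (X , B , x , refl , refl) = inj₂ (X , B , x , refl , refl)

  d^-injective : ∀ k → d^ k v ≡ d^ k w → v ≡ w
  d^-injective zero    eq = eq
  d^-injective (suc k) eq = d^-injective k (∷-injectiveʳ eq)

  -- Classification of linear intervals

  -- The interval [p , q] is totally ordered.
  Linear : ℕ → Word → Word → Set
  Linear i p q = ∀ v w → i ⊢ p ⟶* v → i ⊢ v ⟶* q → i ⊢ p ⟶* w → i ⊢ w ⟶* q →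
                 i ⊢ v ⟶* w ⊎ i ⊢ w ⟶* v

  -- In a linear interval that contains the rotation d^k u X d B of its
  -- bottom d^(k+1) u X B, no element d^(k+1) v other than the bottom exists: the
  -- two have different numbers of leading down steps, so only
  -- d^(k+1) v ≤ d^k u X d B is possible, and stay applies.
  clash : ∀ k → Exc i X → Linear i (d^ (suc k) (u ∷ X ++ B)) q →
          i ⊢ d^ k (u ∷ X ++ d ∷ B) ⟶* q →
          i ⊢ u ∷ X ++ B ⟶* v → i ⊢ d^ (suc k) v ⟶* q → v ≡ u ∷ X ++ B
  clash k x lin s t r with lin _ _ (rotate-last k x) s (prefix-d^ (suc k) t) r
  ... | inj₁ a = ⊥-elim (d^u↛d^suc k a)
  ... | inj₂ a = stay 1 x t (drop-d^ k a)

  -- A linear interval that contains the right interval of height k + 2 with the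
  -- same bottom goes no further.  A rotation of the top u X d^(k+2) B inside X
  -- or B could also be made at the bottom, which clash forbids; and moving the
  -- last down step over an excursion at the start of B gives two incomparable
  -- elements.
  right-maximal : ∀ k → Exc i X → Linear i (d^ (2 + k) (u ∷ X ++ B)) q →
                  i ⊢ u ∷ X ++ d^ (2 + k) B ⟶* q → q ≡ u ∷ X ++ d^ (2 + k) B
  right-maximal k x lin ε = refl
  right-maximal {i} {X} {B} {q} k x lin s@(up r ◅ rs) = ⊥-elim (go (step-split x r))
    where
    forced : ∀ {v} → i ⊢ u ∷ X ++ B ⟶* v → i ⊢ d^ (2 + k) v ⟶* q → v ≡ u ∷ X ++ B
    forced = clash (suc k) x lin
      (subst (λ Z → i ⊢ d^ (suc k) (u ∷ X ++ d ∷ B) ⟶* u ∷ X ++ Z) (d^-comm (suc k) B)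
         (right-sweep (suc k) x) ◅◅ s)
    go : StepSplit (suc i) (δ i) X (d^ (2 + k) B) _ → ⊥
    -- A rotation inside u X.
    go (inside r′ x′ refl)
      with eq ← forced (up (⟶-suffix r′) ◅ ε) (right-sweep (2 + k) x′ ◅◅ rs)
      with refl , _ ← pays-unique x′ x (∷-injectiveʳ eq) = ⟶-irrefl r′ ε
    go (after r′ refl) with rotation-d^ (suc k) r′
    -- A rotation inside B.
    ... | inj₁ (B′ , refl , r″)
          with eq ← forced (prefix (u ∷ X) (r″ ◅ ε)) (right-sweep (2 + k) x ◅◅ rs)
          with refl ← ++-cancelˡ X _ _ (∷-injectiveʳ eq) = ⟶-irrefl r″ ε
    -- A rotation of the last down step over an excursion u Y at the start of B.
    ... | inj₂ (Y , C , y , refl , refl)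
          with lin (d^ (suc k) (u ∷ X ++ u ∷ Y ++ d ∷ C)) (u ∷ X ++ d^ (2 + k) (u ∷ Y ++ C))
                 (rotate-last (suc k) x ◅◅ prefix-d^ (suc k) (prefix (u ∷ X) (rotate y)))
                 (right-sweep (suc k) x ◅◅ rs) (right-sweep (2 + k) x) s
    ...   | inj₂ a = u↛d a
    ...   | inj₁ a with passes (suc k) x x a
    ...     | inj₂ lt = ℕₚ.<-irrefl refl lt
    ...     | inj₁ (_ , b) = d^u↛d^suc (suc k) b
    -- Nothing can cross, as the part after u X starts with a down step.
    go (cross _ () _ _ _)

  -- The two forms of linear intervals, without common prefix.  A right interval
  -- of height 1 is a left one, hence 2 + k.
  data Shape (i : ℕ) (p q : Word) : Set where
    left  : Excs i (suc k) S T → p ≡ d ∷ S ++ B → q ≡ S ++ d ∷ B → Shape i p q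
    right : Exc i X → p ≡ d^ (2 + k) (u ∷ X ++ B) → q ≡ u ∷ X ++ d^ (2 + k) B → Shape i p q

  linear-cancel-d : Linear i (d ∷ p) q → i ⊢ d ∷ v ⟶* q → Linear i p v
  linear-cancel-d lin s v w a b a′ b′
    with lin (d ∷ v) (d ∷ w) (prefix (d ∷ []) a) (prefix (d ∷ []) b ◅◅ s)
                             (prefix (d ∷ []) a′) (prefix (d ∷ []) b′ ◅◅ s)
  ... | inj₁ c = inj₁ (cancel-d c)
  ... | inj₂ c = inj₂ (cancel-d c)

  linear-cancel : ∀ A → Linear i p (A ++ q) → i ⊢ p ⟶* A ++ v → Linear (i ▹ A) v q
  linear-cancel A lin s v w a b a′ b′
    with lin (A ++ v) (A ++ w) (s ◅◅ prefix A a) (prefix A b) (s ◅◅ prefix A a′) (prefix A b′)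
  ... | inj₁ c = inj₁ (cancel A c)
  ... | inj₂ c = inj₂ (cancel A c)

  -- The number n bounds the length of p, for the recursion.
  shape : ∀ n {h} → length p < n → Path h p 0 → Linear i (d ∷ p) (u ∷ q) →
          i ⊢ d ∷ p ⟶* u ∷ q → Shape i (d ∷ p) (u ∷ q)
  shape {p = []} n _ _ lin s with _ , _ , _ , () ◅ _ , _ ← split-d s
  -- P = d d p passes through d C B and C d B, where C = u X.  The interval
  -- [d p , C B] is linear, and shorter.
  shape {p = d ∷ p} {i = i} {q = q} (suc n) (s≤s lt) (down path) lin s
    with X , B , x , s₁ , s₂ ← split-d s
    with shape n lt path (linear-cancel-d lin (rotate x ◅◅ s₂)) s₁
  ... | left (_∷_ {X = Y} y []) e e′ with refl ← e
        with refl , refl ← pays-unique x y (trans (∷-injectiveʳ e′) (++-assoc Y [] _))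
        with refl ← right-maximal 0 x
               (subst (λ Z → Linear i (d ∷ d ∷ u ∷ Z) (u ∷ q)) (++-assoc X [] _) lin) s₂ =
        right {k = 0} x (cong (λ Z → d ∷ d ∷ u ∷ Z) (++-assoc X [] _)) refl
  ... | right {k = k} {B = C} y refl e′
        with refl , refl ← pays-unique x y (∷-injectiveʳ e′)
        with refl ← right-maximal (suc k) x lin s₂ = right {k = suc k} x refl refl
  -- A left interval of height at least 2 is impossible: moving the inner down
  -- step over u X and all the other excursions, or moving both down steps over
  -- u X alone, gives incomparable elements.
  ... | left {B = C} (_∷_ {X = Y} y (_∷_ {X = Z} {S = S} z zs)) refl e′
        with refl , refl ← pays-unique x y (trans (∷-injectiveʳ e′) (++-assoc Y _ _))
        with lin (d ∷ u ∷ Y ++ (u ∷ Z ++ S) ++ d ∷ C) (u ∷ Y ++ d ∷ d ∷ (u ∷ Z ++ S) ++ C)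
               (prefix (d ∷ []) s₁) (rotate x ◅◅ s₂)
               (subst (λ W → i ⊢ d ∷ d ∷ u ∷ W ⟶* u ∷ Y ++ d ∷ d ∷ (u ∷ Z ++ S) ++ C)
                  (sym (++-assoc Y _ C)) (right-sweep 2 x))
               (prefix (u ∷ Y) (prefix (d ∷ []) (left-sweep (z ∷ zs))) ◅◅ s₂)
  ...   | inj₂ a = ⊥-elim (u↛d a)
  ...   | inj₁ a with passes 1 x x a
  ...     | inj₂ lt = ⊥-elim (ℕₚ.<-irrefl refl lt)
  ...     | inj₁ (_ , b) = ⊥-elim (u↛d (cancel-d b))
  -- P = d C B, where C = u X is the opening excursion, and C d B ≤ Q by jump.
  shape {p = u ∷ p} {i = i} {q = q} (suc n) (s≤s lt) (up path) lin s
    with X , B , refl , x ← pays-exists {i = suc i} path (ℕₚ.≤-trans (δ≤1 i) (s≤s z≤n))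
    with s₁ ← jump x s = go (follow x refl (cancel-u s₁))
    where
    forced : ∀ {v} → i ⊢ u ∷ X ++ B ⟶* v → i ⊢ d ∷ v ⟶* u ∷ q → v ≡ u ∷ X ++ B
    forced = clash 0 x lin s₁

    -- The case Q = C B′, where B′ is above d B.
    aligned : ∀ B′ → q ≡ X ++ B′ → suc i ▹ X ⊢ d ∷ B ⟶* B′ → Shape i (d ∷ u ∷ X ++ B) (u ∷ q)
    aligned []       _    s = ⊥-elim (↛[] s)
    aligned (d ∷ B′) refl s
      with eq ← forced (prefix (u ∷ X) (cancel-d s)) (rotate x)
      with refl ← ++-cancelˡ X _ _ (∷-injectiveʳ eq) =
      left (x ∷ []) (cong (λ Z → d ∷ u ∷ Z) (sym (++-assoc X [] B)))
                    (cong (u ∷_) (sym (++-assoc X [] (d ∷ B))))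
    aligned (u ∷ B′) refl s
      with m , _ , z ← path-split X path
      with shape n (shorter X lt) z (linear-cancel (u ∷ X) lin (rotate x)) s
    ... | left {S = S} {B = C} xs refl e =
          left (x ∷ xs) (cong (λ Z → d ∷ u ∷ Z) (sym (++-assoc X S C)))
                        (trans (cong (λ Z → u ∷ X ++ Z) e) (cong (u ∷_) (sym (++-assoc X S (d ∷ C)))))
    -- A right interval of height at least 2 after u X is impossible: its
    -- excursion u Y can pass a down step while the leading one is still in
    -- front of u X.
    ... | right {X = Y} {k = k} {B = C} y refl refl
          with eq ← forced {v = u ∷ X ++ d^ k (u ∷ Y ++ d ∷ C)}
                 (prefix (u ∷ X) (rotate-last k y))
                 (rotate x ◅◅ prefix (u ∷ X)
                   (subst (λ Z → suc i ▹ X ⊢ d^ (suc k) (u ∷ Y ++ d ∷ C) ⟶* u ∷ Y ++ Z)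
                     (d^-comm (suc k) C) (right-sweep (suc k) y)))
          with () ← d^-injective k (trans (++-cancelˡ X _ _ (∷-injectiveʳ eq)) (sym (d^-comm k _)))

    go : Follow (suc i) (δ i) X (d ∷ B) q → Shape i (d ∷ u ∷ X ++ B) (u ∷ q)
    go (parallel {X′} {B′} refl x′ a b)
      with eq ← forced (prefix (u ∷ []) (suffix a))
                  (rotate x′ ◅◅ prefix (u ∷ X′) (subst (_⊢ d ∷ B ⟶* B′) (⟶*-▹ (suc i) a) b))
      with refl , _ ← pays-unique x′ x (∷-injectiveʳ eq) = aligned B′ refl b
    -- The last letter of u X = u C d moves over an excursion.  This is
    -- impossible: one could already move over an excursion u X₃ while the
    -- leading down step is still in front of u X.
    go (longer _ _ _ (crossing {C} {Y} {D} a c b y t))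
      with eq ← forced (prefix (u ∷ []) (suffix a))
                  (rotate c ◅◅ prefix (u ∷ C ++ d ∷ []) (subst (_⊢ d ∷ B ⟶* u ∷ Y ++ D) (⟶*-▹ (suc i) a) b)
                   ◅◅ prefix (u ∷ []) (subst (suc i ⊢_⟶* q) (sym (++-assoc C (d ∷ []) (u ∷ Y ++ D)))
                        (prefix C (rotate y) ◅◅ t)))
      with refl , _ ← pays-unique c x (∷-injectiveʳ eq)
      with X₃ , B₃ , x₃ , s₃ , t₃ ← split-d (subst (_⊢ d ∷ B ⟶* u ∷ Y ++ D) (▹-++ (suc i) C (d ∷ [])) b)
      with eq′ ← forced {v = u ∷ C ++ u ∷ X₃ ++ d ∷ B₃}
             (subst (i ⊢_⟶* u ∷ C ++ u ∷ X₃ ++ d ∷ B₃) (cong (u ∷_) (sym (++-assoc C (d ∷ []) B)))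
               (prefix (u ∷ C) (prefix (d ∷ []) s₃ ◅◅ rotate x₃)))
             (subst₂ (λ V W → i ⊢ d ∷ u ∷ V ⟶* u ∷ W) (sym (cross-assoc C X₃ B₃)) (sym (cross-assoc C X₃ (d ∷ B₃)))
               (rotate (pays-cross C c x₃))
              ◅◅ prefix (u ∷ C) (insert-d-exc x₃ y t₃) ◅◅ prefix (u ∷ []) t)
      with () ← ++-cancelˡ C _ _ (trans (∷-injectiveʳ eq′) (++-assoc C (d ∷ []) B))

  -- Left intervals of height k.
  data LeftInterval (i k : ℕ) (p q : Word) : Set where
    leftInterval : ∀ A → Excs (i ▹ A) k S T → p ≡ A ++ d ∷ S ++ B → q ≡ A ++ S ++ d ∷ B →
                   LeftInterval i k p q

  -- Right intervals of height k.
  data RightInterval (i k : ℕ) (p q : Word) : Set where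
    rightInterval : ∀ A → Exc (i ▹ A) X → p ≡ A ++ d^ k (u ∷ X ++ B) → q ≡ A ++ u ∷ X ++ d^ k B →
                    RightInterval i k p q

  -- The possible shapes of a linear interval; as in Shape, a right interval of
  -- height 1 counts as a left one.
  data Classified (i : ℕ) (p q : Word) : Set where
    trivial : p ≡ q → Classified i p q
    left    : LeftInterval i (suc k) p q → Classified i p q
    right   : RightInterval i (2 + k) p q → Classified i p q

  classified-prefix : ∀ A → Classified (i ▹ A) p q → Classified i (A ++ p) (A ++ q)
  classified-prefix A (trivial refl) = trivial refl
  classified-prefix {i} A (left (leftInterval {S = S} {B = B} A′ xs refl refl)) =
    left (leftInterval {S = S} {B = B} (A ++ A′) (subst (λ j → Excs j _ _ _) (sym (▹-++ i A A′)) xs)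
      (sym (++-assoc A A′ _)) (sym (++-assoc A A′ _)))
  classified-prefix {i} A (right {k = k} (rightInterval {X = X} {B = B} A′ x refl refl)) =
    right {k = k} (rightInterval {X = X} {B = B} (A ++ A′) (subst (λ j → Exc j _) (sym (▹-++ i A A′)) x)
      (sym (++-assoc A A′ _)) (sym (++-assoc A A′ _)))

  classify : ∀ {h} → Path h p 0 → Linear i p q → i ⊢ p ⟶* q → Classified i p q
  classify {p = []} _ _ ε = trivial refl
  classify {p = u ∷ p} (up path) lin s with _ , refl , s′ ← starts-u s =
    classified-prefix (u ∷ []) (classify path (linear-cancel (u ∷ []) lin ε) s′)
  classify {p = d ∷ p} {q = []} path lin s = ⊥-elim (↛[] s)
  classify {p = d ∷ p} {q = d ∷ q} (down path) lin s =
    classified-prefix (d ∷ []) (classify path (linear-cancel (d ∷ []) lin ε) (cancel-d s))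
  classify {p = d ∷ p} {q = u ∷ q} (down path) lin s with shape _ ℕₚ.≤-refl path lin s
  ... | left {S = S} {B = B} xs e e′ = left (leftInterval {S = S} {B = B} [] xs e e′)
  ... | right {X = X} {k = k} {B = B} x e e′ = right {k = k} (rightInterval {X = X} {B = B} [] x e e′)

  left⇒lin : LeftInterval i k p q → Lin i k p q
  left⇒lin (leftInterval A xs refl refl) = lin-prefix A (left-lin xs)

  right⇒lin : RightInterval i k p q → Lin i k p q
  right⇒lin {k = k} (rightInterval A x refl refl) = lin-prefix A (right-lin k x)

  lin⇒linear : Lin i k p q → Linear i p q
  lin⇒linear nil v w a b a′ b′
    with refl ← antisym a b with refl ← antisym a′ b′ = inj₁ ε
  lin⇒linear (cons r f l) v w a b a′ b′ with f v a b | f w a′ b′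
  ... | inj₁ refl | _         = inj₁ a′
  ... | inj₂ _    | inj₁ refl = inj₂ a
  ... | inj₂ c    | inj₂ c′   = lin⇒linear l v w c b c′ b′

  -- The description of rotations by factorisations.
  rotation-parts : i ⊢ v ⟶ w →
    ∃[ A ] ∃[ X ] ∃[ B ] Exc (i ▹ A) X × v ≡ A ++ d ∷ (u ∷ X) ++ B × w ≡ A ++ (u ∷ X) ++ d ∷ B
  rotation-parts (here x refl refl) = [] , _ , _ , x , refl , refl
  rotation-parts (up r)
    with A , X , B , x , refl , refl ← rotation-parts r = u ∷ A , X , B , x , refl , refl
  rotation-parts (down r)
    with A , X , B , x , refl , refl ← rotation-parts r = d ∷ A , X , B , x , refl , refl

  ⟶-path : ∀ {h m} → i ⊢ v ⟶ w → Path h v m → Path h w m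
  ⟶-path (here {X = X} _ refl refl) (down (up p)) with _ , a , b ← path-split X p =
    up (path-++ (path-raise a) (down b))
  ⟶-path (up r)   (up p)   = up (⟶-path r p)
  ⟶-path (down r) (down p) = down (⟶-path r p)

  ⟶*-path : ∀ {h m} → i ⊢ v ⟶* w → Path h v m → Path h w m
  ⟶*-path ε        p = p
  ⟶*-path (r ◅ rs) p = ⟶*-path rs (⟶-path r p)

-- Dyck paths and rotations of Dyck paths

path⇒ballot : ∀ {h w m} → Path h w m → All (λ v → #d v ≤ h + #u v) (inits w)
path⇒ballot []             = z≤n ∷ []
path⇒ballot {h} (up p)   =
  z≤n ∷ Allₚ.map⁺ (All.map (λ {v} → subst (#d v ≤_) (sym (ℕₚ.+-suc h (#u v)))) (path⇒ballot p))
path⇒ballot (down p) = z≤n ∷ Allₚ.map⁺ (All.map s≤s (path⇒ballot p))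

ballot⇒path : ∀ h w → All (λ v → #d v ≤ h + #u v) (inits w) → ∃[ m ] Path h w m
ballot⇒path h []      _        = h , []
ballot⇒path h (u ∷ w) (_ ∷ as)
  with m , p ← ballot⇒path (suc h) w
    (All.map (λ {v} → subst (#d v ≤_) (ℕₚ.+-suc h (#u v))) (Allₚ.map⁻ as)) = m , up p
ballot⇒path zero    (d ∷ w) (_ ∷ () ∷ _)
ballot⇒path (suc h) (d ∷ w) (_ ∷ as)
  with m , p ← ballot⇒path h w (All.map ℕ.s≤s⁻¹ (Allₚ.map⁻ as)) = m , down p

dyck⇒path : ∀ {n} (P : DyckPath n) → Path 0 (word P) 0
dyck⇒path P with m , p ← ballot⇒path 0 (word P) (ballot P) = subst (Path 0 (word P)) m≡0 p
  where
  m≡0 : m ≡ 0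
  m≡0 = ℕₚ.+-cancelˡ-≡ (#d (word P)) m 0
    (trans (sym (path-balance p)) (cong (_+ 0) (trans (ups P) (sym (downs P)))))

path⇒dyck : ∀ {n w} → Path 0 w 0 → #u w ≡ n → DyckPath n
path⇒dyck {w = w} p e = record
  { word   = w
  ; ups    = e
  ; downs  = trans (sym (ℕₚ.+-identityʳ _)) (trans (sym (path-balance p)) (trans (ℕₚ.+-identityʳ _) e))
  ; ballot = path⇒ballot p
  }

module AltTamari {n : ℕ} (δ : Increment n) where

  -- The values of δ-up as natural numbers.
  value : ℕ → ℕ
  value i = ∣ δ-up δ i ∣

  δ-up≡value : ∀ i → δ-up δ i ≡ pos (value i)
  δ-up≡value i with i <? n
  ... | yes _ = refl
  ... | no  _ = refl

  value≤1 : ∀ i → value i ≤ 1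
  value≤1 i with i <? n
  ... | yes i<n = ℕ.s≤s⁻¹ (toℕ<n (δ (fromℕ< i<n)))
  ... | no  _   = z≤n

  open Rotations value value≤1 public

  -- The condition that X leads from δ-level l to 0 is expressed as
  -- δ-sum δ i X + l = 0.
  sum-u : ∀ i l w → δ-sum δ i (u ∷ w) ℤ.+ pos l ≡ δ-sum δ (suc i) w ℤ.+ pos (value i + l)
  sum-u i l w rewrite δ-up≡value i =
    trans (cong (ℤ._+ pos l) (ℤₚ.+-comm (pos (value i)) s)) (ℤₚ.+-assoc s (pos (value i)) (pos l))
    where s = δ-sum δ (suc i) w

  sum-d : ∀ i l w → δ-sum δ i (d ∷ w) ℤ.+ pos (suc l) ≡ δ-sum δ i w ℤ.+ pos l
  sum-d i l w = trans (cong (ℤ._+ pos (suc l)) (ℤₚ.+-comm -1ℤ s)) (ℤₚ.+-assoc s -1ℤ (pos (suc l)))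
    where s = δ-sum δ i w

  pays-sum : ∀ {i l X} → Pays i l X → δ-sum δ i X ℤ.+ pos l ≡ 0ℤ
  pays-sum done = refl
  pays-sum {i} {suc l} {u ∷ w} (up x)   = trans (sum-u i (suc l) w) (pays-sum x)
  pays-sum {i} {suc l} {d ∷ w} (down x) = trans (sum-d i l w) (pays-sum x)

  -- Level 0 is not reached earlier than at the end of X.
  pays-shortest : ∀ {i l X Y} Z {Z′} → Pays i l X → X ++ Y ≡ Z ++ Z′ →
    δ-sum δ i Z ℤ.+ pos l ≡ 0ℤ → length X ≤ length Z
  pays-shortest Z       done     _ _ = z≤n
  pays-shortest []      (up x)   _ ()
  pays-shortest []      (down x) _ ()
  pays-shortest {i} {suc l} (u ∷ Z) (up x) e s =
    s≤s (pays-shortest Z x (∷-injectiveʳ e) (trans (sym (sum-u i (suc l) Z)) s))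
  pays-shortest {i} {suc l} (d ∷ Z) (down x) e s =
    s≤s (pays-shortest Z x (∷-injectiveʳ e) (trans (sym (sum-d i l Z)) s))
  pays-shortest (d ∷ Z) (up x) () s
  pays-shortest (u ∷ Z) (down x) () s

  exc-sum : ∀ i w → δ-sum δ i (u ∷ w) ≡ δ-sum δ (suc i) w ℤ.+ pos (value i)
  exc-sum i w = trans (sym (ℤₚ.+-identityʳ _))
    (trans (sum-u i 0 w) (cong (λ m → δ-sum δ (suc i) w ℤ.+ pos m) (ℕₚ.+-identityʳ (value i))))

  exc⇒excursion : ∀ {i X} B → Exc i X → IsExcursion δ i ((u ∷ X) ++ B) (u ∷ X)
  exc⇒excursion {i} {X} B x =
    record { starts-with-u = X , refl ; is-prefix = B , refl ; sum-zero = trans (exc-sum i X) (pays-sum x) }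
    , shortest
    where
    shortest : ∀ Z → IsBalanced δ i ((u ∷ X) ++ B) Z → length (u ∷ X) ≤ length Z
    shortest _ record { starts-with-u = Z , refl ; is-prefix = _ , e ; sum-zero = s } =
      s≤s (pays-shortest Z x (sym (∷-injectiveʳ e)) (trans (sym (exc-sum i Z)) s))

  -- An excursion in the sense of Pays exists, as the word is a suffix of a Dyck
  -- path; both are shortest, so they agree.
  excursion⇒exc : ∀ {i h C B} → Path h (C ++ B) 0 → IsExcursion δ i (C ++ B) C →
                  ∃[ X ] C ≡ u ∷ X × Exc i X
  excursion⇒exc {i} {B = B} (up p) (record { starts-with-u = X , refl ; sum-zero = s } , shortest)
    with X′ , B′ , e , x ← pays-exists {i = suc i} p (ℕₚ.≤-trans (value≤1 i) (s≤s z≤n))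
    with refl ← ++-length-unique X X′ e (ℕₚ.≤-antisym
      (ℕ.s≤s⁻¹ (shortest (u ∷ X′) record { starts-with-u = X′ , refl ; is-prefix = B′ , cong (u ∷_) (sym e)
                                 ; sum-zero = trans (exc-sum i X′) (pays-sum x) }))
      (pays-shortest X x (sym e) (trans (sym (exc-sum i X)) s))) = X , refl , x

  0▹ : ∀ A → 0 ▹ A ≡ #u A
  0▹ A = trans (▹-#u 0 A) (ℕₚ.+-identityʳ (#u A))

  rotation⇒⟶ : ∀ {P Q} → Rotation δ P Q → 0 ⊢ word P ⟶ word Q
  rotation⇒⟶ {P} record { A = A ; C = C ; B = B ; source = s ; target = t ; excursion = e }
    with m , _ , down p ← path-split A (subst (λ w → Path 0 w 0) s (dyck⇒path P))
    with X , refl , x ← excursion⇒exc p e =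
    subst₂ (0 ⊢_⟶_) (sym s) (sym t)
      (⟶-prefix A (here (subst (λ i → Exc i X) (sym (0▹ A)) x) refl refl))

  ⟶⇒rotation : ∀ {P Q : DyckPath n} → 0 ⊢ word P ⟶ word Q → Rotation δ P Q
  ⟶⇒rotation r with A , X , B , x , s , t ← rotation-parts r = record
    { A = A ; C = u ∷ X ; B = B ; source = s ; target = t
    ; excursion = exc⇒excursion B (subst (λ i → Exc i X) (0▹ A) x) }

  _⊑_ : DyckPath n → DyckPath n → Set
  _⊑_ = Star (Rotation δ)

  ⊑⇒⟶* : ∀ {P Q} → P ⊑ Q → 0 ⊢ word P ⟶* word Q
  ⊑⇒⟶* = gmap word rotation⇒⟶

  -- Words above a Dyck path are Dyck paths.
  target : ∀ {w} (P : DyckPath n) → 0 ⊢ word P ⟶* w → ∃[ Q ] word {n} Q ≡ w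
  target P s = path⇒dyck (⟶*-path s (dyck⇒path P)) (trans (sym (⟶*-#u s)) (ups P)) , refl

  ⟶*⇒⊑ : ∀ {P Q} → 0 ⊢ word P ⟶* word Q → P ⊑ Q
  ⟶*⇒⊑ {P} {Q} s = go P refl s
    where
    go : ∀ {w} P → word P ≡ w → 0 ⊢ w ⟶* word Q → P ⊑ Q
    go P e ε with refl ← word-injective {P = P} {Q} e = ε
    go P refl (r ◅ rs) with P′ , refl ← target P (r ◅ ε) = ⟶⇒rotation r ◅ go P′ refl rs

  open Intervals (Tam δ) hiding (LinearIntervalOfHeight)

  isLinear⇒linear : ∀ {P Q} → IsLinear P Q → Linear 0 (word P) (word Q)
  isLinear⇒linear {P} lin v w a b a′ b′
    with R , refl ← target P a | S , refl ← target P a′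
    with lin R S (⟶*⇒⊑ a , ⟶*⇒⊑ b) (⟶*⇒⊑ a′ , ⟶*⇒⊑ b′)
  ... | inj₁ c = inj₁ (⊑⇒⟶* c)
  ... | inj₂ c = inj₂ (⊑⇒⟶* c)

  linear⇒isLinear : ∀ {P Q} → Linear 0 (word P) (word Q) → IsLinear P Q
  linear⇒isLinear lin R S (a , b) (a′ , b′)
    with lin _ _ (⊑⇒⟶* a) (⊑⇒⟶* b) (⊑⇒⟶* a′) (⊑⇒⟶* b′)
  ... | inj₁ c = inj₁ (⟶*⇒⊑ c)
  ... | inj₂ c = inj₂ (⟶*⇒⊑ c)

  lin⇒chain : ∀ {k P Q w} → word P ≡ w → Lin 0 k w (word Q) → Chain P Q k
  lin⇒chain {P = P} {Q} e nil = stop (word-injective {P = P} {Q} e)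
  lin⇒chain {P = P} refl (cons r _ l) with R , refl ← target P (r ◅ ε) =
    step (⟶*⇒⊑ {P} {R} (r ◅ ε) , λ { refl → ⟶-irrefl r ε }) (lin⇒chain {P = R} refl l)

  chain⇒⟶* : ∀ {P Q k} → Chain P Q k → 0 ⊢ word P ⟶* word Q
  chain⇒⟶* (stop refl)       = ε
  chain⇒⟶* (step (a , _) c) = ⊑⇒⟶* a ◅◅ chain⇒⟶* c

  -- A chain that ends at the top of the interval and starts at one of its
  -- elements is no longer than the interval; the proof follows the interval
  -- upwards.
  lin-bound : ∀ {k Q R p j} → Lin 0 k p (word Q) → 0 ⊢ p ⟶* word R → Chain R Q j → j ≤ k
  lin-bound nil s (stop _) = z≤n
  lin-bound {R = R} nil s (step {R = S} (a , ne) c) =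
    ⊥-elim (ne (word-injective {P = R} {S} (antisym (⊑⇒⟶* a) (chain⇒⟶* c ◅◅ s))))
  lin-bound {R = R} l@(cons _ f l′) s c with f _ s (chain⇒⟶* c)
  ... | inj₂ s′ = ℕₚ.m≤n⇒m≤1+n (lin-bound l′ s′ c)
  lin-bound l@(cons _ f l′) s (stop _) | inj₁ _ = z≤n
  lin-bound {R = R} l@(cons _ f l′) s (step {R = S} (a , ne) c) | inj₁ refl
    with f _ (⊑⇒⟶* a) (chain⇒⟶* c)
  ... | inj₁ e  = ⊥-elim (ne (word-injective {P = R} {S} (sym e)))
  ... | inj₂ s′ = s≤s (lin-bound l′ s′ c)

  lin⇒interval : ∀ {k P Q} → Lin 0 k (word P) (word Q) → LinearIntervalOfHeight (Tam δ) k (P , Q)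
  lin⇒interval l = ⟶*⇒⊑ (lin⇒⟶* l) , linear⇒isLinear (lin⇒linear l) ,
                   lin⇒chain refl l , λ j → lin-bound l ε

  height-unique : ∀ {P Q j k} → HasHeight P Q j → HasHeight P Q k → j ≡ k
  height-unique (c , m) (c′ , m′) = ℕₚ.≤-antisym (m′ _ c) (m _ c′)

  interval-class : ∀ {k P Q} → LinearIntervalOfHeight (Tam δ) k (P , Q) → Classified 0 (word P) (word Q)
  interval-class {P = P} (s , lin , _) = classify (dyck⇒path P) (isLinear⇒linear lin) (⊑⇒⟶* s)

  same-height : ∀ {j k P Q} → LinearIntervalOfHeight (Tam δ) k (P , Q) → Lin 0 j (word P) (word Q) → j ≡ k
  same-height (_ , _ , h) l = height-unique (proj₂ (proj₂ (lin⇒interval l))) h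

-- Cardinalities of predicates

open import Data.Nat.Combinatorics
  using (_C_; nCk+nC[k+1]≡[n+1]C[k+1]; nCk≡nC[n∸k]; nCn≡1; nC1≡n; k>n⇒nCk≡0)

card-empty : ∀ {A : Set} {S : A → Set} → (∀ x → ¬ S x) → HasCardinality S 0
card-empty ¬S = [] , [] , (λ x → mk⇔ (λ ()) (⊥-elim ∘ ¬S x)) , refl

card-singleton : ∀ {A : Set} {S : A → Set} x → S x → (∀ y → S y → y ≡ x) → HasCardinality S 1
card-singleton {S = S} x s only =
  x ∷ [] , [] ∷ [] , (λ y → mk⇔ (λ { (here refl) → s }) (here ∘ only y)) , refl

card-≡ : ∀ {a} {A : Set} {S : A → Set a} {m n} → m ≡ n → HasCardinality S m → HasCardinality S n
card-≡ refl c = c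

card-⇔ : ∀ {a b} {A : Set} {S : A → Set a} {T : A → Set b} {n} →
  (∀ x → S x → T x) → (∀ x → T x → S x) → HasCardinality S n → HasCardinality T n
card-⇔ f g (xs , uniq , mem , len) =
  xs , uniq , (λ x → mk⇔ (f x ∘ to (mem x)) (from (mem x) ∘ g x)) , len

card-⊎ : ∀ {A : Set} {S T : A → Set} {m n} → (∀ x → S x → ¬ T x) →
  HasCardinality S m → HasCardinality T n → HasCardinality (λ x → S x ⊎ T x) (m + n)
card-⊎ {S = S} {T} disj (xs , uxs , mxs , refl) (ys , uys , mys , refl) =
  xs ++ ys ,
  ++⁺ uxs uys (λ { {x} (p , q) → disj x (to (mxs x) p) (to (mys x) q) }) ,
  (λ x → mk⇔ (Sum.map (to (mxs x)) (to (mys x)) ∘ ∈-++⁻ xs)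
    Sum.[ ∈-++⁺ˡ ∘ from (mxs x) , ∈-++⁺ʳ xs ∘ from (mys x) ]) ,
  length-++ xs

-- Cardinalities are transferred along a bijective relation R between S and T.
module _ {A B : Set} {b} {S : A → Set} {T : B → Set b} (R : A → B → Set)
  (total : ∀ x → S x → ∃[ y ] T y × R x y)
  (onto  : ∀ y → T y → ∃[ x ] S x × R x y)
  (functional : ∀ {x y y′} → R x y → R x y′ → y ≡ y′)
  (injective  : ∀ {x x′ y} → R x y → R x′ y → x ≡ x′) where

  private
    images : ∀ {xs} → All S xs → ∃[ ys ] Pointwise R xs ys × All T ys
    images [] = [] , [] , []
    images (s ∷ ss) with y , t , r ← total _ s | ys , rs , ts ← images ss =
      y ∷ ys , r ∷ rs , t ∷ ts

    images-fresh : ∀ {x y xs ys} → R x y → Pointwise R xs ys → All (x ≢_) xs → All (y ≢_) ys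
    images-fresh r []       []       = []
    images-fresh r (q ∷ rs) (x≢ ∷ f) = (λ { refl → x≢ (injective r q) }) ∷ images-fresh r rs f

    images-unique : ∀ {xs ys} → Pointwise R xs ys → Unique xs → Unique ys
    images-unique []       []       = []
    images-unique (r ∷ rs) (f ∷ us) = images-fresh r rs f ∷ images-unique rs us

    image-∈ : ∀ {x y xs ys} → R x y → Pointwise R xs ys → x ∈ xs → y ∈ ys
    image-∈ r (q ∷ rs) (here refl) = here (functional r q)
    image-∈ r (q ∷ rs) (there p)   = there (image-∈ r rs p)

  card-transfer : ∀ {n} → HasCardinality S n → HasCardinality T n
  card-transfer (xs , uniq , mem , len)
    with ys , rs , ts ← images (All.tabulate {xs = xs} (λ {x} → to (mem x))) =
    ys , images-unique rs uniq ,
    (λ y → mk⇔ (All.lookup ts)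
      (λ t → let x , s , r = onto y t in image-∈ r rs (from (mem x) s))) ,
    trans (sym (Pointwise-length rs)) len

card-∷ : ∀ {S : Word → Set} {n} x → HasCardinality (S ∘ (x ∷_)) n →
  HasCardinality (λ w → ∃[ v ] w ≡ x ∷ v × S w) n
card-∷ x = card-transfer (λ v w → w ≡ x ∷ v)
  (λ v s → x ∷ v , (v , refl , s) , refl)
  (λ { _ (v , refl , s) → v , s , refl })
  (λ { refl refl → refl }) (λ { refl refl → refl })

-- Words are counted by their first letter.
card-words : ∀ {S : Word → Set} {m n} → ¬ S [] →
  HasCardinality (S ∘ (u ∷_)) m → HasCardinality (S ∘ (d ∷_)) n → HasCardinality S (m + n)
card-words {S} ¬[] cu cd = card-⇔ (λ { _ (inj₁ (_ , _ , s)) → s ; _ (inj₂ (_ , _ , s)) → s }) split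
  (card-⊎ (λ { _ (_ , refl , _) (_ , () , _) }) (card-∷ u cu) (card-∷ d cd))
  where
  split : ∀ w → S w → (∃[ v ] w ≡ u ∷ v × S w) ⊎ (∃[ v ] w ≡ d ∷ v × S w)
  split []      s = ⊥-elim (¬[] s)
  split (u ∷ w) s = inj₁ (w , refl , s)
  split (d ∷ w) s = inj₂ (w , refl , s)

-- Binomial coefficients

nC0≡1 : ∀ n → n C 0 ≡ 1
nC0≡1 n = trans (nCk≡nC[n∸k] {n = n} z≤n) (nCn≡1 n)

-- Pascal's rule with a possibly negative lower index b - l.
binomial-pascal : ∀ m b l → binomial m (b ⊖ suc l) + binomial m (b ⊖ l) ≡ binomial (suc m) (b ⊖ l)
binomial-pascal m zero    zero    = trans (nC0≡1 m) (sym (nC0≡1 (suc m)))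
binomial-pascal m zero    (suc l) = refl
binomial-pascal m (suc b) zero    = nCk+nC[k+1]≡[n+1]C[k+1] m b
binomial-pascal m (suc b) (suc l)
  rewrite [1+m]⊖[1+n]≡m⊖n b (suc l) | [1+m]⊖[1+n]≡m⊖n b l = binomial-pascal m b l

-- Both sides are 1 if b = l and 0 if b < l.
binomial-≤ : ∀ m m′ {b l} → b ≤ l → binomial m (b ⊖ l) ≡ binomial m′ (b ⊖ l)
binomial-≤ m m′ {l = zero}  z≤n = trans (nC0≡1 m) (sym (nC0≡1 m′))
binomial-≤ m m′ {l = suc l} z≤n = refl
binomial-≤ m m′ (s≤s {b} {l} b≤l) rewrite [1+m]⊖[1+n]≡m⊖n b l = binomial-≤ m m′ b≤l

absorption : ∀ m k → suc k * (m C suc k) + k * (m C k) ≡ m * (m C k)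
absorption zero zero = refl
absorption zero (suc k)
  rewrite k>n⇒nCk≡0 {0} {suc k} (s≤s z≤n) | k>n⇒nCk≡0 {0} {suc (suc k)} (s≤s z≤n)
        | ℕₚ.*-zeroʳ k = refl
absorption (suc m) zero rewrite nC1≡n (suc m) | nC0≡1 (suc m) =
  solve 1 (λ m → con 1 :* (con 1 :+ m) :+ con 0 :* con 1 := (con 1 :+ m) :* con 1) refl m
  where open +-*-Solver
absorption (suc m) (suc k)
  rewrite sym (nCk+nC[k+1]≡[n+1]C[k+1] m (suc k)) | sym (nCk+nC[k+1]≡[n+1]C[k+1] m k) = begin
    suc (suc k) * (b + c) + suc k * (a + b)
      ≡⟨ solve 4 (λ k a b c → (con 2 :+ k) :* (b :+ c) :+ (con 1 :+ k) :* (a :+ b) :=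
           ((con 2 :+ k) :* c :+ (con 1 :+ k) :* b) :+ ((con 1 :+ k) :* b :+ k :* a) :+ (a :+ b)) refl k a b c ⟩
    (suc (suc k) * c + suc k * b) + (suc k * b + k * a) + (a + b)
      ≡⟨ cong₂ (λ x y → x + y + (a + b)) (absorption m (suc k)) (absorption m k) ⟩
    m * b + m * a + (a + b)
      ≡⟨ solve 3 (λ m a b → m :* b :+ m :* a :+ (a :+ b) := (con 1 :+ m) :* (a :+ b)) refl m a b ⟩
    suc m * (a + b) ∎
  where
  open ≡-Reasoning
  open +-*-Solver
  a = m C k
  b = m C suc k
  c = m C suc (suc k)

-- Words that reach a given level

-- Words with a up steps and b down steps.
WithLetters : ℕ → ℕ → Word → Set
WithLetters a b w = #u w ≡ a × #d w ≡ b

card-withLetters : ∀ a b → HasCardinality (WithLetters a b) ((a + b) C b)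
card-withLetters zero zero = card-singleton [] (refl , refl)
  λ { [] _ → refl ; (u ∷ w) (() , _) ; (d ∷ w) (_ , ()) }
card-withLetters zero (suc b) = card-≡ (trans (nCn≡1 b) (sym (nCn≡1 (suc b))))
  (card-words (λ { (_ , ()) }) (card-empty λ { _ (() , _) })
    (card-⇔ (λ _ (e , f) → e , cong suc f) (λ _ (e , f) → e , ℕₚ.suc-injective f) (card-withLetters zero b)))
card-withLetters (suc a) zero = card-≡ (trans (ℕₚ.+-identityʳ _) (trans (nC0≡1 (a + 0)) (sym (nC0≡1 (suc (a + 0))))))
  (card-words (λ { (() , _) })
    (card-⇔ (λ _ (e , f) → cong suc e , f) (λ _ (e , f) → ℕₚ.suc-injective e , f) (card-withLetters a zero))
    (card-empty λ { _ (_ , ()) }))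
card-withLetters (suc a) (suc b) = card-≡ count
  (card-words (λ { (() , _) })
    (card-⇔ (λ _ (e , f) → cong suc e , f) (λ _ (e , f) → ℕₚ.suc-injective e , f) (card-withLetters a (suc b)))
    (card-⇔ (λ _ (e , f) → e , cong suc f) (λ _ (e , f) → e , ℕₚ.suc-injective f) (card-withLetters (suc a) b)))
  where
  count : (a + suc b) C suc b + (suc a + b) C b ≡ (suc a + suc b) C suc b
  count rewrite ℕₚ.+-suc a b =
    trans (ℕₚ.+-comm (suc (a + b) C suc b) (suc (a + b) C b)) (nCk+nC[k+1]≡[n+1]C[k+1] (suc (a + b)) b)

-- Hits l w: starting from level l, the word w visits level 0.
Hits : ℕ → Word → Set
Hits zero    w       = ⊤
Hits (suc l) []      = ⊥
Hits (suc l) (u ∷ w) = Hits (suc (suc l)) w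
Hits (suc l) (d ∷ w) = Hits l w

card-hits : ∀ a b l → b ≤ a + l →
  HasCardinality (λ w → WithLetters a b w × Hits l w) (binomial (a + b) (b ⊖ l))
card-hits a b zero _ = card-⇔ (λ _ e → e , tt) (λ _ → proj₁) (card-withLetters a b)
card-hits zero zero (suc l) _ = card-empty λ { [] (_ , ()) ; (u ∷ w) ((() , _) , _) ; (d ∷ w) ((_ , ()) , _) }
card-hits zero (suc b) (suc l) (s≤s b≤l) = card-≡ count
  (card-words (λ { (_ , ()) }) (card-empty λ { _ ((() , _) , _) })
    (card-⇔ (λ _ ((e , f) , h) → (e , cong suc f) , h) (λ _ ((e , f) , h) → (e , ℕₚ.suc-injective f) , h)
      (card-hits zero b l b≤l)))
  where
  count : binomial b (b ⊖ l) ≡ binomial (suc b) (suc b ⊖ suc l)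
  count rewrite [1+m]⊖[1+n]≡m⊖n b l = binomial-≤ b (suc b) b≤l
card-hits (suc a) zero (suc l) _ = card-words (λ { (_ , ()) })
    (card-⇔ (λ _ ((e , f) , h) → (cong suc e , f) , h) (λ _ ((e , f) , h) → (ℕₚ.suc-injective e , f) , h)
      (card-hits a zero (2 + l) z≤n))
    (card-empty λ { _ ((_ , ()) , _) })
card-hits (suc a) (suc b) (suc l) le@(s≤s b≤) = card-≡ count
  (card-words (λ { (_ , ()) })
    (card-⇔ (λ _ ((e , f) , h) → (cong suc e , f) , h) (λ _ ((e , f) , h) → (ℕₚ.suc-injective e , f) , h)
      (card-hits a (suc b) (2 + l) (subst (suc b ≤_) (sym (ℕₚ.+-suc a (suc l))) le)))
    (card-⇔ (λ _ ((e , f) , h) → (e , cong suc f) , h) (λ _ ((e , f) , h) → (e , ℕₚ.suc-injective f) , h)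
      (card-hits (suc a) b l (subst (b ≤_) (ℕₚ.+-suc a l) b≤))))
  where
  count : binomial (a + suc b) (suc b ⊖ (2 + l)) + binomial (suc a + b) (b ⊖ l) ≡
          binomial (suc a + suc b) (suc b ⊖ suc l)
  count rewrite ℕₚ.+-suc a b | [1+m]⊖[1+n]≡m⊖n b l | [1+m]⊖[1+n]≡m⊖n b (suc l) =
    binomial-pascal (suc (a + b)) b l

-- Ballot and Catalan numbers

-- The number of paths from level h to level 0 with a up steps is
-- C(2a + h, a) - C(2a + h, a - 1).  The subtraction is moved to the other side.
card-ballot : ∀ a h → ∃[ N ] HasCardinality (λ w → Path h w 0 × #u w ≡ a) N ×
  N + binomial (a + (a + h)) (a ⊖ 1) ≡ (a + (a + h)) C a
card-ballot zero zero = 1 , card-singleton [] ([] , refl)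
  (λ { [] _ → refl ; (u ∷ w) (_ , ()) ; (d ∷ w) (() , _) }) , sym (nC0≡1 0)
card-ballot zero (suc h) with N , c , e ← card-ballot zero h =
  N , card-words (λ { (() , _) }) (card-empty λ { _ (_ , ()) })
        (card-⇔ (λ { _ (p , e) → down p , e }) (λ { _ (down p , e) → p , e }) c)
    , trans e (trans (nC0≡1 h) (sym (nC0≡1 (suc h))))
card-ballot (suc a) zero with N , c , e ← card-ballot a 1 =
  N + 0 , card-words (λ { (_ , ()) })
        (card-⇔ (λ { _ (p , e) → up p , cong suc e }) (λ { _ (up p , e) → p , ℕₚ.suc-injective e }) c)
        (card-empty λ { _ (() , _) })
    , formula
  where
  m = a + (a + 1)
  symmetric : m C suc a ≡ m C a
  symmetric = trans (nCk≡nC[n∸k] (subst (suc a ≤_) m≡ (ℕₚ.m≤m+n (suc a) a)))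
                    (cong (m C_) (trans (cong (_∸ suc a) (sym m≡)) (ℕₚ.m+n∸m≡n (suc a) a)))
    where
    m≡ : suc a + a ≡ m
    m≡ = trans (sym (ℕₚ.+-suc a a)) (cong (a +_) (ℕₚ.+-comm 1 a))
  formula : N + 0 + (suc a + (suc a + 0)) C a ≡ (suc a + (suc a + 0)) C suc a
  formula rewrite sym (ℕₚ.+-suc a 0) | sym (binomial-pascal m a 0) | sym (nCk+nC[k+1]≡[n+1]C[k+1] m a) | symmetric =
    trans (cong (_+ (binomial m (a ⊖ 1) + m C a)) (ℕₚ.+-identityʳ N))
      (trans (sym (ℕₚ.+-assoc N _ _)) (cong (_+ m C a) e))
card-ballot (suc a) (suc h) with N₁ , c₁ , e₁ ← card-ballot a (2 + h) | N₂ , c₂ , e₂ ← card-ballot (suc a) h =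
  N₁ + N₂ , card-words (λ { (() , _) })
        (card-⇔ (λ { _ (p , e) → up p , cong suc e }) (λ { _ (up p , e) → p , ℕₚ.suc-injective e }) c₁)
        (card-⇔ (λ { _ (p , e) → down p , e }) (λ { _ (down p , e) → p , e }) c₂)
    , formula
  where
  m = a + (a + (2 + h))
  m≡ : suc a + (suc a + h) ≡ m
  m≡ = solve 2 (λ a h → con 1 :+ a :+ (con 1 :+ a :+ h) := a :+ (a :+ (con 2 :+ h))) refl a h
    where open +-*-Solver
  m′≡ : a + (suc a + suc h) ≡ m
  m′≡ = cong (a +_) (sym (ℕₚ.+-suc a (suc h)))
  formula : N₁ + N₂ + (suc a + (suc a + suc h)) C a ≡ (suc a + (suc a + suc h)) C suc a
  formula rewrite m′≡ | sym (binomial-pascal m a 0) | sym (nCk+nC[k+1]≡[n+1]C[k+1] m a) = begin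
    N₁ + N₂ + (binomial m (a ⊖ 1) + m C a)
      ≡⟨ solve 4 (λ x y z w → x :+ y :+ (z :+ w) := (x :+ z) :+ (y :+ w)) refl N₁ N₂ (binomial m (a ⊖ 1)) (m C a) ⟩
    (N₁ + binomial m (a ⊖ 1)) + (N₂ + m C a)
      ≡⟨ cong₂ _+_ e₁ (subst (λ x → N₂ + x C a ≡ x C suc a) m≡ e₂) ⟩
    m C a + m C suc a ∎
    where
    open ≡-Reasoning
    open +-*-Solver

-- From N = C(2n, n) - C(2n, n - 1) to (n + 1) N = C(2n, n).
catalan : ∀ n {N} → N + binomial (n + (n + 0)) (n ⊖ 1) ≡ (n + (n + 0)) C n → suc n * N ≡ (2 * n) C n
catalan zero {N} e = trans (ℕₚ.+-identityʳ N) (trans (sym (ℕₚ.+-identityʳ N)) e)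
catalan (suc n) {N} e = ℕₚ.+-cancelʳ-≡ (suc n * c + suc n * b) (suc (suc n) * N) c (begin
    suc (suc n) * N + (suc n * c + suc n * b)
      ≡⟨ solve 4 (λ n N b c → (con 2 :+ n) :* N :+ ((con 1 :+ n) :* c :+ (con 1 :+ n) :* b) :=
           ((con 1 :+ n) :* c :+ n :* b) :+ (b :+ N :+ (con 1 :+ n) :* N)) refl n N b c ⟩
    (suc n * c + n * b) + (b + N + suc n * N)
      ≡⟨ cong (_+ (b + N + suc n * N)) (absorption m n) ⟩
    m * b + (b + N + suc n * N)
      ≡⟨ solve 3 (λ n N b → (con 2 :* (con 1 :+ n)) :* b :+ (b :+ N :+ (con 1 :+ n) :* N) :=
           (N :+ b) :+ ((con 1 :+ n) :* (N :+ b) :+ (con 1 :+ n) :* b)) refl n N b ⟩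
    (N + b) + (suc n * (N + b) + suc n * b)
      ≡⟨ cong (λ x → x + (suc n * x + suc n * b)) e ⟩
    c + (suc n * c + suc n * b) ∎)
  where
  open ≡-Reasoning
  open +-*-Solver
  m = 2 * suc n
  b = m C n
  c = m C suc n

-- Decomposition at the first minimum

-- The decomposition of w at the first visit of its minimum, which comes right
-- after the distinguished down step.
data MinSplit (w : Word) : Set where
  minSplit : ∀ R A {r h} → w ≡ R ++ d ∷ A → Path r R 0 → Path 0 A h → MinSplit w

-- The alternative is that the minimum is the starting level.
split-min : ∀ w → (∃[ h ] Path 0 w h) ⊎ MinSplit w
split-min [] = inj₁ (0 , [])
split-min (u ∷ w) with split-min w
... | inj₁ (h , p) = inj₁ (suc h , up (path-raise p))
... | inj₂ (minSplit R A {zero} e p q)  =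
      inj₁ (_ , subst (λ w → Path 0 (u ∷ w) _) (sym e) (up (path-++ (path-raise p) (down q))))
... | inj₂ (minSplit R A {suc r} e p q) = inj₂ (minSplit (u ∷ R) A (cong (u ∷_) e) (up p) q)
split-min (d ∷ w) with split-min w
... | inj₁ (h , p)              = inj₂ (minSplit [] w refl [] p)
... | inj₂ (minSplit R A e p q) = inj₂ (minSplit (d ∷ R) A (cong (d ∷_) e) (down p) q)

path-hits : ∀ {g w h} l → Path g w h → Hits l w → l ≤ g
path-hits zero    _        _ = z≤n
path-hits (suc l) (up p)   x = ℕ.s≤s⁻¹ (path-hits (suc (suc l)) p x)
path-hits (suc l) (down p) x = s≤s (path-hits l p x)

hits-min : ∀ {r} R {A} l → Path r R 0 → l ≤ r → Hits (suc l) (R ++ d ∷ A)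
hits-min [] .0 [] z≤n = tt
hits-min (u ∷ R) l       (up p)   l≤r       = hits-min R (suc l) p (s≤s l≤r)
hits-min (d ∷ R) zero    (down p) _         = tt
hits-min (d ∷ R) (suc l) (down p) (s≤s l≤r) = hits-min R l p l≤r

-- If R were a proper prefix of R′, the distinguished down step of R′ would
-- take A below its starting level.
min-unique : ∀ {r r′ h h′} R R′ {A A′} → R ++ d ∷ A ≡ R′ ++ d ∷ A′ →
  Path r R 0 → Path r′ R′ 0 → Path 0 A h → Path 0 A′ h′ → R ≡ R′
min-unique []      []       e p p′ q q′ = refl
min-unique []      (x ∷ R′) refl p (down p′) q q′
  with m , a , down b ← path-split R′ q with path-end (path-raise^ _ a) p′
... | ()
min-unique (x ∷ R) []       refl (down p) p′ q q′
  with m , a , down b ← path-split R q′ with path-end (path-raise^ _ a) p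
... | ()
min-unique (u ∷ R) (u ∷ R′) e (up p)   (up p′)   q q′ = cong (u ∷_) (min-unique R R′ (∷-injectiveʳ e) p p′ q q′)
min-unique (d ∷ R) (d ∷ R′) e (down p) (down p′) q q′ = cong (d ∷_) (min-unique R R′ (∷-injectiveʳ e) p p′ q q′)

-- The pairs (R , A) such that R d A is cut at the first visit of its minimum,
-- at least l + 1 below the start, and has a up steps and b down steps.
data Halves (l a b : ℕ) : Word × Word → Set where
  halves : ∀ {R A r h} → Path r R 0 → Path 0 A h → l ≤ r →
           #u R + #u A ≡ a → suc (#d R + #d A) ≡ b → Halves l a b (R , A)

card-halves : ∀ a b l → b ≤ a + suc l → HasCardinality (Halves l a b) (binomial (a + b) (b ⊖ suc l))
card-halves a b l b≤ = card-transfer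
  (λ { w (R , A) → w ≡ R ++ d ∷ A × ∃[ r ] ∃[ h ] Path r R 0 × Path 0 A h })
  total
  (λ { (R , A) (halves p q l≤r e f) → R ++ d ∷ A ,
       ((trans (#u-++ R (d ∷ A)) e , trans (#d-++ R (d ∷ A)) (trans (ℕₚ.+-suc (#d R) (#d A)) f)) , hits-min R l p l≤r) ,
       refl , _ , _ , p , q })
  (λ { {y = R , A} {R′ , A′} (refl , _ , _ , p , q) (e , _ , _ , p′ , q′) → functional R R′ e p p′ q q′ })
  (λ { (refl , _) (refl , _) → refl })
  (card-hits a b (suc l) b≤)
  where
  total : ∀ w → WithLetters a b w × Hits (suc l) w →
    ∃[ y ] Halves l a b y × (w ≡ proj₁ y ++ d ∷ proj₂ y × ∃[ r ] ∃[ h ] Path r (proj₁ y) 0 × Path 0 (proj₂ y) h)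
  total w ((e , f) , x) with split-min w
  ... | inj₁ (_ , p) with () ← path-hits (suc l) p x
  ... | inj₂ (minSplit R A refl p q) = (R , A) , halves p q
          (ℕ.s≤s⁻¹ (path-hits (suc l) (path-++ (path-raise p) (down q)) x))
          (trans (sym (#u-++ R (d ∷ A))) e)
          (trans (sym (ℕₚ.+-suc (#d R) (#d A))) (trans (sym (#d-++ R (d ∷ A))) f)) ,
          refl , _ , _ , p , q
  functional : ∀ {r r′ h h′} R R′ {A A′} → R ++ d ∷ A ≡ R′ ++ d ∷ A′ →
    Path r R 0 → Path r′ R′ 0 → Path 0 A h → Path 0 A′ h′ → (R , A) ≡ (R′ , A′)
  functional R R′ e p p′ q q′ with refl ← min-unique R R′ e p p′ q q′
    with refl ← ++-cancelˡ R _ _ e = refl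

-- Encoding and counting of linear intervals

module Counting {n : ℕ} (δ : Increment n) where
  open AltTamari δ

  Pair : Set
  Pair = DyckPath n × DyckPath n

  LeftPair RightPair : ℕ → Pair → Set
  LeftPair  k (P , Q) = LeftInterval 0 k (word P) (word Q)
  RightPair k (P , Q) = RightInterval 0 k (word P) (word Q)

  pair-≡ : ∀ {P Q P′ Q′ : DyckPath n} → word P ≡ word P′ → word Q ≡ word Q′ → (P , Q) ≡ (P′ , Q′)
  pair-≡ {P} {Q} {P′} {Q′} e f = cong₂ _,_ (word-injective {P = P} {P′} e) (word-injective {P = Q} {Q′} f)

  -- The pair (R , A) encodes the right interval with bottom A d^k u R, whose
  -- excursion u X is the one that starts with the displayed up step.
  data RightCode (k : ℕ) : Word × Word → Pair → Set where
    rightCode : ∀ {A X B R P Q} → Exc (0 ▹ A) X → R ≡ X ++ B →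
      word P ≡ A ++ d^ k (u ∷ X ++ B) → word Q ≡ A ++ u ∷ X ++ d^ k B → RightCode k (R , A) (P , Q)

  -- Counting letters shows that A ends k levels above the level where the
  -- displayed up step starts; so the encoded word is a Dyck path.
  right-total : ∀ {a b} k → suc a ≡ n → b + k ≡ suc n → ∀ y → Halves 1 a b y →
    ∃[ z ] RightPair k z × RightCode k y z
  right-total k n≡ b≡ (R , A) (halves {r = suc r} {h} p q _ refl refl)
    with X , B , refl , x ← pays-exists {i = suc (0 ▹ A)} p (ℕₚ.≤-trans (value≤1 (0 ▹ A)) (s≤s z≤n)) =
    (P , proj₁ Q) , rightInterval A x refl (proj₂ Q) , rightCode x refl refl (proj₂ Q)
    where
    open +-*-Solver
    h≡ : h ≡ k + r
    h≡ = ℕₚ.+-cancelˡ-≡ (2 + #u R + #d A) h (k + r) (begin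
      2 + #u R + #d A + h
        ≡⟨ solve 3 (λ x y z → con 2 :+ x :+ y :+ z := con 2 :+ x :+ (y :+ z)) refl (#u R) (#d A) h ⟩
      2 + #u R + (#d A + h)
        ≡⟨ cong (2 + #u R +_) (trans (sym (path-balance q)) (ℕₚ.+-identityʳ (#u A))) ⟩
      2 + #u R + #u A
        ≡⟨ cong suc n≡ ⟩
      suc n
        ≡⟨ sym b≡ ⟩
      suc (#d R + #d A) + k
        ≡⟨ cong (λ x → suc (x + #d A) + k) (trans (sym (ℕₚ.+-identityʳ (#d R))) (sym (path-balance p))) ⟩
      suc (#u R + suc r + #d A) + k
        ≡⟨ solve 4 (λ x y r k → con 1 :+ (x :+ (con 1 :+ r) :+ y) :+ k := con 2 :+ x :+ y :+ (k :+ r)) refl (#u R) (#d A) r k ⟩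
      2 + #u R + #d A + (k + r) ∎)
      where open ≡-Reasoning
    count : #u (A ++ d^ k (u ∷ R)) ≡ n
    count = trans (#u-++ A _) (trans (cong (#u A +_) (#u-d^ k (u ∷ R)))
      (trans (ℕₚ.+-suc (#u A) (#u R)) (trans (cong suc (ℕₚ.+-comm (#u A) (#u R))) n≡)))
    P : DyckPath n
    P = path⇒dyck (path-++ (subst (Path 0 A) h≡ q) (path-d^ k (up p))) count
    Q = target P (lin⇒⟶* (right⇒lin (rightInterval {k = k} A x refl refl)))

  right-onto : ∀ {a b} k → suc a ≡ n → b + k ≡ suc n → ∀ z → RightPair k z →
    ∃[ y ] Halves 1 a b y × RightCode k y z
  right-onto {a} {b} k n≡ b≡ (P , Q) (rightInterval {X = X} {B = B} A x e e′)
    with m , q , p′ ← path-split A (subst (λ w → Path 0 w 0) e (dyck⇒path P))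
    with r , refl , up p ← path-d^⁻ k p′ =
    (X ++ B , A) , halves p q (s≤s z≤n) us ds , rightCode x refl e e′
    where
    R = X ++ B
    us : #u R + #u A ≡ a
    us = ℕₚ.suc-injective (begin
      suc (#u R + #u A)           ≡⟨ ℕₚ.+-comm (suc (#u R)) (#u A) ⟩
      #u A + #u (u ∷ R)           ≡⟨ cong (#u A +_) (sym (#u-d^ k (u ∷ R))) ⟩
      #u A + #u (d^ k (u ∷ R))    ≡⟨ sym (#u-++ A _) ⟩
      #u (A ++ d^ k (u ∷ R))      ≡⟨ cong #u (sym e) ⟩
      #u (word P)                 ≡⟨ ups P ⟩
      n                           ≡⟨ sym n≡ ⟩
      suc a                       ∎)
      where open ≡-Reasoning
    ds : suc (#d R + #d A) ≡ b
    ds = ℕₚ.+-cancelʳ-≡ k (suc (#d R + #d A)) b (begin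
      suc (#d R + #d A) + k       ≡⟨ solve 3 (λ x y k → con 1 :+ (x :+ y) :+ k := con 1 :+ (y :+ (k :+ x))) refl (#d R) (#d A) k ⟩
      suc (#d A + (k + #d R))     ≡⟨ cong (λ x → suc (#d A + x)) (sym (#d-d^ k (u ∷ R))) ⟩
      suc (#d A + #d (d^ k (u ∷ R))) ≡⟨ cong suc (sym (#d-++ A _)) ⟩
      suc (#d (A ++ d^ k (u ∷ R))) ≡⟨ cong (suc ∘ #d) (sym e) ⟩
      suc (#d (word P))           ≡⟨ cong suc (downs P) ⟩
      suc n                       ≡⟨ sym b≡ ⟩
      b + k                       ∎)
      where
      open ≡-Reasoning
      open +-*-Solver

  right-functional : ∀ k {y z z′} → RightCode k y z → RightCode k y z′ → z ≡ z′
  right-functional k (rightCode x refl e f) (rightCode x′ e₀ e′ f′)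
    with refl , refl ← pays-unique x x′ e₀ = pair-≡ (trans e (sym e′)) (trans f (sym f′))

  right-injective : ∀ k {y y′ z} → RightCode (suc k) y z → RightCode (suc k) y′ z → y ≡ y′
  right-injective k (rightCode {A} x refl e f) (rightCode {A′} x′ refl e′ f′)
    with refl , e″ , _ ← common-prefix A A′ (trans (sym e) e′) (trans (sym f) f′) =
    cong (_, A) (∷-injectiveʳ (d^-injective k e″))

  card-right : ∀ k c → suc (suc k) + c ≡ n →
    HasCardinality (RightPair (suc k)) (binomial (2 * n ∸ suc k) (n ⊖ suc (suc k)))
  card-right k c refl = card-≡ count
    (card-transfer (RightCode (suc k)) (right-total {suc k + c} {2 + c} (suc k) refl b≡) (right-onto (suc k) refl b≡)
      (right-functional (suc k)) (right-injective k)
      (card-halves (suc k + c) (2 + c) 1 (subst (2 + c ≤_) (ℕₚ.+-comm 2 (suc k + c)) (s≤s (s≤s (ℕₚ.m≤n+m c (suc k)))))))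
    where
    open +-*-Solver
    b≡ : 2 + c + suc k ≡ suc n
    b≡ = solve 2 (λ k c → con 2 :+ c :+ (con 1 :+ k) := con 3 :+ k :+ c) refl k c
    lower : (2 + c) ⊖ 2 ≡ n ⊖ suc (suc k)
    lower = sym (trans (cong (n ⊖_) (sym (ℕₚ.+-identityʳ (2 + k)))) (ℤₚ.+-cancelˡ-⊖ (2 + k) c 0))
    upper : suc k + c + (2 + c) ≡ 2 * n ∸ suc k
    upper = sym (trans (cong (_∸ suc k)
      (solve 2 (λ k c → con 2 :* (con 2 :+ k :+ c) := con 1 :+ k :+ (con 1 :+ k :+ c :+ (con 2 :+ c))) refl k c))
      (ℕₚ.m+n∸m≡n (suc k) _))
    count : binomial (suc k + c + (2 + c)) ((2 + c) ⊖ 2) ≡ binomial (2 * n ∸ suc k) (n ⊖ suc (suc k))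
    count = cong₂ binomial upper lower

  -- Encoding of left intervals

  -- If the δ-level does not exceed the level of the path at the start, it never
  -- does; so the path does not go below level 0 before the δ-level does.
  pays-path : ∀ {i l X h} → Pays i l X → l ≤ h → ∃[ m ] Path h X m
  pays-path done _ = _ , []
  pays-path {i} (up x) l≤h with m , p ← pays-path x (ℕₚ.+-mono-≤ (value≤1 i) l≤h) = m , up p
  pays-path (down x) (s≤s l≤h) with m , p ← pays-path x l≤h = m , down p

  -- The up steps that open k excursions are put back: one in front of the word,
  -- the next one where the excursion opened by the first ends, and so on.  Each
  -- of them raises what follows by one level, so the start is k levels lower.
  excs-exist : ∀ k {i h w} → Path (h + k) w 0 →
    ∃[ S ] ∃[ T ] ∃[ B ] w ≡ T ++ B × Excs i k S T × Path h (S ++ B) 0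
  excs-exist zero {h = h} {w} p = [] , [] , w , refl , [] , subst (λ m → Path m w 0) (ℕₚ.+-identityʳ h) p
  excs-exist (suc k) {i} {h} {w} p rewrite ℕₚ.+-suc h k
    with X , Y , refl , x ← pays-exists {i = suc i} p (ℕₚ.≤-trans (value≤1 i) (s≤s z≤n))
    with m , q ← pays-path {h = suc h} x (ℕₚ.≤-trans (value≤1 i) (s≤s z≤n))
    with m′ , p₁ , p₂ ← path-split X p
    with refl ← path-end p₁ (path-raise^ k q)
    with S , T , B , refl , xs , p₃ ← excs-exist k {suc i ▹ X} p₂ =
    u ∷ X ++ S , X ++ T , B , sym (++-assoc X T B) , x ∷ xs ,
    subst (λ Z → Path h (u ∷ Z) 0) (sym (++-assoc X S B)) (up (path-++ q p₃))

  excs-path : ∀ {i k S T h B} → Excs i k S T → Path h (S ++ B) 0 → Path (h + k) (T ++ B) 0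
  excs-path {h = h} {B} [] p = subst (λ m → Path m B 0) (sym (ℕₚ.+-identityʳ h)) p
  excs-path {k = suc k} {h = h} {B} (_∷_ {X = X} {S = S} {T = T} x xs) (up p)
    with m , p₁ , p₂ ← path-split X (subst (λ Z → Path (suc h) Z 0) (++-assoc X S B) p) =
    subst₂ (λ g Z → Path g Z 0) (sym (ℕₚ.+-suc h k)) (sym (++-assoc X T B))
      (path-++ (path-raise^ k p₁) (excs-path xs p₂))

  excs-uniqueᵀ : ∀ {i k S S′ T T′ B B′} → Excs i k S T → Excs i k S′ T′ → T ++ B ≡ T′ ++ B′ → S ≡ S′ × B ≡ B′
  excs-uniqueᵀ [] [] e = refl , e
  excs-uniqueᵀ (_∷_ {X = X} {T = T} x xs) (_∷_ {X = X′} {T = T′} x′ xs′) e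
    with refl , e′ ← pays-unique x x′ (trans (sym (++-assoc X T _)) (trans e (++-assoc X′ T′ _)))
    with refl , refl ← excs-uniqueᵀ xs xs′ e′ = refl , refl

  excs-uniqueˢ : ∀ {i k S S′ T T′ B B′} → Excs i k S T → Excs i k S′ T′ → S ++ B ≡ S′ ++ B′ → T ≡ T′ × B ≡ B′
  excs-uniqueˢ [] [] e = refl , e
  excs-uniqueˢ (_∷_ {X = X} {S = S} x xs) (_∷_ {X = X′} {S = S′} x′ xs′) e
    with refl , e′ ← pays-unique x x′ (trans (sym (++-assoc X S _)) (trans (∷-injectiveʳ e) (++-assoc X′ S′ _)))
    with refl , refl ← excs-uniqueˢ xs xs′ e′ = refl , refl

  excs-#u : ∀ {i k S T} → Excs i k S T → #u S ≡ k + #u T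
  excs-#u [] = refl
  excs-#u {k = suc k} (_∷_ {X = X} {S = S} {T = T} x xs) = cong suc (begin
    #u (X ++ S)          ≡⟨ #u-++ X S ⟩
    #u X + #u S          ≡⟨ cong (#u X +_) (excs-#u xs) ⟩
    #u X + (k + #u T)    ≡⟨ solve 3 (λ x k t → x :+ (k :+ t) := k :+ (x :+ t)) refl (#u X) k (#u T) ⟩
    k + (#u X + #u T)    ≡⟨ cong (k +_) (sym (#u-++ X T)) ⟩
    k + #u (X ++ T)      ∎)
    where
    open ≡-Reasoning
    open +-*-Solver

  excs-#d : ∀ {i k S T} → Excs i k S T → #d S ≡ #d T
  excs-#d [] = refl
  excs-#d (_∷_ {X = X} {S = S} {T = T} x xs) =
    trans (#d-++ X S) (trans (cong (#d X +_) (excs-#d xs)) (sym (#d-++ X T)))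

  -- The pair (R , A) encodes the left interval with bottom A d S B, where
  -- R = T B arises from S B by deleting the up steps that open the excursions.
  data LeftCode (k : ℕ) : Word × Word → Pair → Set where
    leftCode : ∀ {A S T B R P Q} → Excs (0 ▹ A) k S T → R ≡ T ++ B →
      word P ≡ A ++ d ∷ S ++ B → word Q ≡ A ++ S ++ d ∷ B → LeftCode k (R , A) (P , Q)

  left-#u : ∀ A {i k S T B} → Excs i k S T → #u (A ++ d ∷ S ++ B) ≡ #u (T ++ B) + #u A + k
  left-#u A {k = k} {S} {T} {B} xs = begin
    #u (A ++ d ∷ S ++ B)        ≡⟨ #u-++ A _ ⟩
    #u A + #u (S ++ B)          ≡⟨ cong (#u A +_) (trans (#u-++ S B) (cong (_+ #u B) (excs-#u xs))) ⟩
    #u A + (k + #u T + #u B)    ≡⟨ solve 4 (λ a k t b → a :+ (k :+ t :+ b) := t :+ b :+ a :+ k) refl (#u A) k (#u T) (#u B) ⟩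
    #u T + #u B + #u A + k      ≡⟨ cong (λ x → x + #u A + k) (sym (#u-++ T B)) ⟩
    #u (T ++ B) + #u A + k      ∎
    where
    open ≡-Reasoning
    open +-*-Solver

  -- Counting letters shows that A ends at level h with h + k = r + 1; since
  -- k ≤ r, this level is positive, which leaves room for the down step after A.
  left-total : ∀ {a} k → a + k ≡ n → ∀ y → Halves k a n y → ∃[ z ] LeftPair k z × LeftCode k y z
  left-total k n≡ (R , A) (halves {r = r} {h} p q k≤r refl f) = go h h+k≡ q
    where
    open +-*-Solver
    h+k≡ : h + k ≡ suc r
    h+k≡ = ℕₚ.+-cancelˡ-≡ (#u R + #d A) (h + k) (suc r) (begin
      #u R + #d A + (h + k)
        ≡⟨ solve 4 (λ x y h k → x :+ y :+ (h :+ k) := x :+ (y :+ h) :+ k) refl (#u R) (#d A) h k ⟩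
      #u R + (#d A + h) + k
        ≡⟨ cong (λ x → #u R + x + k) (trans (sym (path-balance q)) (ℕₚ.+-identityʳ (#u A))) ⟩
      #u R + #u A + k
        ≡⟨ n≡ ⟩
      n
        ≡⟨ sym f ⟩
      suc (#d R + #d A)
        ≡⟨ cong (λ x → suc (x + #d A)) (trans (sym (ℕₚ.+-identityʳ (#d R))) (sym (path-balance p))) ⟩
      suc (#u R + r + #d A)
        ≡⟨ solve 3 (λ x y r → con 1 :+ (x :+ r :+ y) := x :+ y :+ (con 1 :+ r)) refl (#u R) (#d A) r ⟩
      #u R + #d A + suc r ∎)
      where open ≡-Reasoning
    go : ∀ h → h + k ≡ suc r → Path 0 A h → ∃[ z ] LeftPair k z × LeftCode k (R , A) z
    go zero    e    q = ⊥-elim (ℕₚ.<-irrefl e (s≤s k≤r))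
    go (suc h) refl q
      with S , T , B , refl , xs , p′ ← excs-exist k {0 ▹ A} {h} p =
      (P , proj₁ Q) , leftInterval {S = S} {B = B} A xs refl (proj₂ Q) , leftCode xs refl refl (proj₂ Q)
      where
      P : DyckPath n
      P = path⇒dyck (path-++ q (down p′)) (trans (left-#u A xs) n≡)
      Q = target P (lin⇒⟶* (left⇒lin (leftInterval {S = S} {B = B} A xs refl refl)))

  left-onto : ∀ {a} k → a + k ≡ n → ∀ z → LeftPair k z → ∃[ y ] Halves k a n y × LeftCode k y z
  left-onto {a} k n≡ (P , Q) (leftInterval {S = S} {T = T} {B = B} A xs e e′)
    with suc h , q , down p ← path-split A (subst (λ w → Path 0 w 0) e (dyck⇒path P)) =
    (T ++ B , A) , halves (excs-path xs p) q (ℕₚ.m≤n+m k h) us ds , leftCode xs refl e e′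
    where
    us : #u (T ++ B) + #u A ≡ a
    us = ℕₚ.+-cancelʳ-≡ k _ a (trans (sym (left-#u A xs)) (trans (cong #u (sym e)) (trans (ups P) (sym n≡))))
    ds : suc (#d (T ++ B) + #d A) ≡ n
    ds = begin
      suc (#d (T ++ B) + #d A)     ≡⟨ cong (λ x → suc (x + #d A)) (trans (#d-++ T B) (trans (cong (_+ #d B) (sym (excs-#d xs))) (sym (#d-++ S B)))) ⟩
      suc (#d (S ++ B) + #d A)     ≡⟨ ℕₚ.+-comm (suc (#d (S ++ B))) (#d A) ⟩
      #d A + #d (d ∷ S ++ B)       ≡⟨ sym (#d-++ A _) ⟩
      #d (A ++ d ∷ S ++ B)         ≡⟨ cong #d (sym e) ⟩
      #d (word P)                  ≡⟨ downs P ⟩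
      n                            ∎
      where open ≡-Reasoning

  left-functional : ∀ k {y z z′} → LeftCode k y z → LeftCode k y z′ → z ≡ z′
  left-functional k (leftCode {S = S} x refl e f) (leftCode {S = S′} x′ e₀ e′ f′)
    with refl , refl ← excs-uniqueᵀ x x′ e₀ = pair-≡ (trans e (sym e′)) (trans f (sym f′))

  left-injective : ∀ k {y y′ z} → LeftCode (suc k) y z → LeftCode (suc k) y′ z → y ≡ y′
  left-injective k (leftCode {A} xs@(_ ∷ _) refl e f) (leftCode {A′} xs′@(_ ∷ _) refl e′ f′)
    with refl , e″ , _ ← common-prefix A A′ (trans (sym e) e′) (trans (sym f) f′)
    with T≡ , refl ← excs-uniqueˢ xs xs′ e″ = cong (λ T → T ++ _ , A) T≡

  card-left : ∀ k a → a + suc k ≡ n →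
    HasCardinality (LeftPair (suc k)) (binomial (2 * n ∸ suc k) (n ⊖ suc (suc k)))
  card-left k a n≡ = card-≡ (cong (λ m → binomial m (n ⊖ suc (suc k))) upper)
    (card-transfer (LeftCode (suc k)) (left-total (suc k) n≡) (left-onto (suc k) n≡)
      (left-functional (suc k)) (left-injective k)
      (card-halves a n (suc k) (subst (_≤ a + suc (suc k)) n≡ (ℕₚ.+-monoʳ-≤ a (ℕₚ.n≤1+n (suc k))))))
    where
    upper : a + n ≡ 2 * n ∸ suc k
    upper = begin
      a + n                    ≡⟨ cong (_+ n) (sym (ℕₚ.m+n∸n≡m a (suc k))) ⟩
      a + suc k ∸ suc k + n    ≡⟨ cong (λ x → x ∸ suc k + n) n≡ ⟩
      n ∸ suc k + n            ≡⟨ sym (ℕₚ.+-∸-comm n (subst (suc k ≤_) n≡ (ℕₚ.m≤n+m (suc k) a))) ⟩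
      n + n ∸ suc k            ≡⟨ cong (λ x → n + x ∸ suc k) (sym (ℕₚ.+-identityʳ n)) ⟩
      2 * n ∸ suc k            ∎
      where open ≡-Reasoning

  -- Numbers of linear intervals

  left-bound : ∀ k z → LeftPair k z → k < n
  left-bound k (P , Q) (leftInterval {S = S} {T = T} {B = B} A xs e e′)
    with suc h , q , _ ← path-split A (subst (λ w → Path 0 w 0) e (dyck⇒path P)) =
    subst (k <_) (trans (sym (left-#u A xs)) (trans (cong #u (sym e)) (ups P)))
      (ℕₚ.m<n+m k (ℕₚ.<-≤-trans (#u-pos q) (ℕₚ.m≤n+m (#u A) (#u (T ++ B)))))
    where
    #u-pos : ∀ {A h} → Path 0 A (suc h) → 0 < #u A
    #u-pos (up _) = s≤s z≤n

  right-bound : ∀ k z → RightPair k z → k < n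
  right-bound k (P , Q) (rightInterval {X = X} {B = B} A x e e′)
    with m , q , p ← path-split A (subst (λ w → Path 0 w 0) e (dyck⇒path P))
    with r , refl , _ ← path-d^⁻ k p = begin-strict
      k                              ≤⟨ ℕₚ.m≤m+n k r ⟩
      k + r                          ≤⟨ ℕₚ.m≤n+m (k + r) (#d A) ⟩
      #d A + (k + r)                 ≡⟨ trans (sym (path-balance q)) (ℕₚ.+-identityʳ (#u A)) ⟩
      #u A                           <⟨ ℕₚ.m<m+n (#u A) (s≤s z≤n) ⟩
      #u A + #u (u ∷ X ++ B)         ≡⟨ cong (#u A +_) (sym (#u-d^ k _)) ⟩
      #u A + #u (d^ k (u ∷ X ++ B))  ≡⟨ sym (#u-++ A _) ⟩
      #u (A ++ d^ k (u ∷ X ++ B))    ≡⟨ cong #u (sym e) ⟩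
      #u (word P)                    ≡⟨ ups P ⟩
      n                              ∎
    where open ℕₚ.≤-Reasoning

  Interval : ℕ → Pair → Set
  Interval = LinearIntervalOfHeight (Tam δ)

  -- Right intervals are needed from height 2 on only.
  interval-cases : ∀ k z → Interval (suc k) z →
    LeftPair (suc k) z ⊎ (∃[ j ] k ≡ suc j) × RightPair (suc k) z
  interval-cases k z i with interval-class i
  ... | trivial e with () ← same-height i (subst (Lin 0 0 _) e nil)
  interval-cases k z i | left l with refl ← same-height i (left⇒lin l) = inj₁ l
  interval-cases k z i | right {k = j} r with refl ← same-height i (right⇒lin r) = inj₂ ((j , refl) , r)

  left-interval : ∀ k z → LeftPair k z → Interval k z
  left-interval k z l = lin⇒interval (left⇒lin l)

  right-interval : ∀ k z → RightPair k z → Interval k z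
  right-interval k z l = lin⇒interval (right⇒lin l)

  left-right-disjoint : ∀ k z → LeftPair (2 + k) z → ¬ RightPair (2 + k) z
  left-right-disjoint k z (leftInterval A (_ ∷ _) e f) (rightInterval A′ _ e′ f′)
    with common-prefix A A′ (trans (sym e) e′) (trans (sym f) f′)
  ... | _ , () , _

  card-height-0 : ∃[ N ] (suc n * N ≡ (2 * n) C n × HasCardinality (Interval 0) N)
  card-height-0 with N , c , e ← card-ballot n 0 = N , catalan n e ,
    card-transfer (λ { w (P , Q) → word P ≡ w × P ≡ Q })
      (λ w (p , e) → let P = path⇒dyck p e in (P , P) , lin⇒interval nil , refl , refl)
      (λ { (P , Q) (_ , _ , Intervals.stop refl , _) → word P , (dyck⇒path P , ups P) , refl , refl })
      (λ { {y = P , _} {P′ , _} (refl , refl) (e , refl) → pair-≡ (sym e) (sym e) })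
      (λ { (refl , _) (refl , _) → refl }) c

  card-height-1 : 1 ≤ n → HasCardinality (Interval 1) (binomial (2 * n ∸ 1) (n ⊖ 2))
  card-height-1 1≤n = card-⇔ (left-interval 1)
    (λ z i → Sum.[ id , (λ { ((_ , ()) , _) }) ] (interval-cases 0 z i))
    (card-left 0 (n ∸ 1) (ℕₚ.m∸n+n≡m 1≤n))

  card-height-≥2 : ∀ k → 2 ≤ k → k < n →
    HasCardinality (Interval k) (2 * binomial (2 * n ∸ k) (n ⊖ suc k))
  card-height-≥2 (suc (suc k)) (s≤s (s≤s _)) k<n = card-≡ (cong (N +_) (sym (ℕₚ.+-identityʳ N)))
    (card-⇔ (λ z → Sum.[ left-interval _ z , right-interval _ z ])
      (λ z i → Sum.map₂ proj₂ (interval-cases _ z i))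
      (card-⊎ (left-right-disjoint k)
        (card-left (suc k) (n ∸ (2 + k)) (ℕₚ.m∸n+n≡m (ℕₚ.<⇒≤ k<n)))
        (card-right (suc k) (n ∸ (3 + k)) (ℕₚ.m+[n∸m]≡n k<n))))
    where N = binomial (2 * n ∸ (2 + k)) (n ⊖ (3 + k))

  no-height-≥n : 1 ≤ n → ∀ k → n ≤ k → ∀ z → ¬ Interval k z
  no-height-≥n 1≤n zero    n≤k z i = ℕₚ.<⇒≱ 1≤n n≤k
  no-height-≥n 1≤n (suc k) n≤k z i with interval-cases k z i
  ... | inj₁ l       = ℕₚ.<⇒≱ (left-bound _ z l) n≤k
  ... | inj₂ (_ , r) = ℕₚ.<⇒≱ (right-bound _ z r) n≤k

theorem0p1 : ∀ (n : ℕ) → 1 ≤ n → (δ : Increment n) →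
    (∃[ N ] (suc n * N ≡ (2 * n) C n ×
    HasCardinality (LinearIntervalOfHeight (Tam δ) 0) N)) ×
    HasCardinality (LinearIntervalOfHeight (Tam δ) 1) (binomial (2 * n ∸ 1) (n ⊖ 2)) ×
    (∀ k → 2 ≤ k → k < n →
    HasCardinality (LinearIntervalOfHeight (Tam δ) k) (2 * binomial (2 * n ∸ k) (n ⊖ suc k))) ×
    (∀ k → n ≤ k → ∀ PQ → ¬ LinearIntervalOfHeight (Tam δ) k PQ)
theorem0p1 n 1≤n δ = card-height-0 , card-height-1 1≤n , card-height-≥2 , no-height-≥n 1≤n
  where open Counting δ
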